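{- For all sufficiently large $n$, the threshold biases of the $(1:q)$ $K_4$-Game and of the $(1:q)$ Budget $K_4$-Game on $K_n$ satisfy $$q_{K_4}(n)\ge 6\cdot 10^{ -6}\,n^{2/5}\qquad\text{and}\qquad q_{K_4}^b(n)\ge 6\cdot 10^{ -6}\,n^{2/5}.$$
   Context: The $(1:q)$ $K_4$-Game on the complete graph $K_n$ is played by Maker and Breaker. In each round, Maker first claims one previously unclaimed edge of $K_n$, whereafter Breaker claims $q$ previously unclaimed edges of $K_n$ (unless fewer than $q$ unclaimed edges remain, in which case he claims all remaining edges). Maker wins if at some point she has claimed all six edges of a copy of $K_4$ in $K_n$. Breaker wins if he has claimed at least one edge of each copy of $K_4$ in $K_n$. The threshold bias $q_{K_4}(n)$ is the smallest non-negative integer $q$ such that Breaker has a winning strategy in this game. The $(1:q)$ Budget $K_4$-Game is the variant in which, in his turn, Breaker may instead claim an arbitrary number (possibly zero) of previously unclaimed edges of $K_n$, subject to the condition that at the end of his turn the total number of edges claimed by Breaker so far is at most $q$ times the total number of edges claimed by Maker so far; everything else is unchanged. Its threshold bias, the smallest non-negative integer $q$ such that Breaker has a winning strategy, is denoted $q_{K_4}^b(n)$. -}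

module Defs where

open import Data.Fin using (Fin; _<_)
open import Data.Fin.Subset using (Subset; ∣_∣) renaming (_∈_ to _∈ₛ_)
open import Data.List using (List; []; _∷_; _++_; length)
open import Data.List.Membership.Propositional using (_∈_; _∉_)
open import Data.List.Relation.Unary.All using (All)
open import Data.List.Relation.Unary.Unique.Propositional using (Unique)
open import Data.Nat using (ℕ; _*_; _^_; _≤_) renaming (_<_ to _<ⁿ_)
open import Data.Product using (_×_; ∃-syntax)
open import Data.Sum using (_⊎_)
open import Relation.Binary.PropositionalEquality using (_≡_)

-- An edge {i , j} of Kₙ is represented by its endpoints in increasing order.
-- Since _<_ is proof-irrelevant, _≡_ on Edge n is equality of endpoints.
record Edge (n : ℕ) : Set where
  constructor edge
  field
    lo hi : Fin n
    lo<hi : lo < hi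

open Edge public

-- A copy of K₄ in Kₙ is given by its set of four vertices.
_isEdgeOf_ : ∀ {n} → Edge n → Subset n → Set
e isEdgeOf S = lo e ∈ₛ S × hi e ∈ₛ S

HitsEveryK₄ : ∀ {n} → List (Edge n) → Set
HitsEveryK₄ {n} B = (S : Subset n) → ∣ S ∣ ≡ 4 → ∃[ e ] e ∈ B × e isEdgeOf S

AllClaimed : ∀ {n} → (M B : List (Edge n)) → Set
AllClaimed {n} M B = (e : Edge n) → e ∈ M ⊎ e ∈ B

Unclaimed : ∀ {n} → (M B : List (Edge n)) → Edge n → Set
Unclaimed M B e = e ∉ M × e ∉ B

-- A rule restricts how many edges Breaker takes in his turn: M and B are the
-- edges claimed by Maker (including her move of this round) and by Breaker
-- before the turn, and R is the list of edges Breaker claims in this turn.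
Rule : ℕ → Set₁
Rule n = (M B R : List (Edge n)) → Set

biasRule : ∀ {n} → ℕ → Rule n
biasRule q M B R = length R ≡ q ⊎ (length R <ⁿ q × AllClaimed M (R ++ B))

budgetRule : ∀ {n} → ℕ → Rule n
budgetRule q M B R = length (R ++ B) ≤ q * length M

LegalTurn : ∀ {n} → Rule n → (M B R : List (Edge n)) → Set
LegalTurn rule M B R = Unique R × All (Unclaimed M B) R × rule M B R

-- Given the list of all of Maker's moves so far, most recent first, a strategy
-- returns the edges Breaker claims in the current round.  Breaker's own earlier
-- moves are determined by the strategy, so this is the full history.
Strategy : ℕ → Set
Strategy n = List (Edge n) → List (Edge n)

breakerEdges : ∀ {n} → Strategy n → List (Edge n) → List (Edge n)
breakerEdges σ []       = []
breakerEdges σ (m ∷ ms) = σ (m ∷ ms) ++ breakerEdges σ ms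

-- Play σ ms: Maker can play the moves ms (most recent first) against σ.
data Play {n : ℕ} (σ : Strategy n) : List (Edge n) → Set where
  start : Play σ []
  move  : ∀ {m ms} → Play σ ms → Unclaimed ms (breakerEdges σ ms) m → Play σ (m ∷ ms)

IsLegal : ∀ {n} → Rule n → Strategy n → Set
IsLegal rule σ = ∀ {m ms} → Play σ (m ∷ ms) →
  LegalTurn rule (m ∷ ms) (breakerEdges σ ms) (σ (m ∷ ms))

-- Plays are continued until all edges are claimed, even after one player has
-- won.  This does not affect the winner: claims are never revoked, and once all
-- edges are claimed, Maker owns a K₄ exactly if Breaker has missed one.
IsWinning : ∀ {n} → Rule n → Strategy n → Set
IsWinning rule σ = IsLegal rule σ ×
  (∀ {ms} → Play σ ms → AllClaimed ms (breakerEdges σ ms) → HitsEveryK₄ (breakerEdges σ ms))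

BreakerHasWinningStrategy : ∀ {n} → Rule n → Set
BreakerHasWinningStrategy rule = ∃[ σ ] IsWinning rule σ

IsThresholdBias : ∀ {n} → (ℕ → Rule n) → ℕ → Set
IsThresholdBias game q =
  BreakerHasWinningStrategy (game q) ×
  (∀ q′ → BreakerHasWinningStrategy (game q′) → q ≤ q′)

IsK₄Threshold : (n q : ℕ) → Set
IsK₄Threshold n = IsThresholdBias (biasRule {n})

IsBudgetK₄Threshold : (n q : ℕ) → Set
IsBudgetK₄Threshold n = IsThresholdBias (budgetRule {n})

-- The inequality q ≥ 6 · 10⁻⁶ · n^(2/5) between nonnegative reals, multiplied by
-- 10⁶ and raised to the fifth power.
_≥6·10⁻⁶·_^⅖ : (q n : ℕ) → Set
q ≥6·10⁻⁶· n ^⅖ = 6 ^ 5 * n ^ 2 ≤ (10 ^ 6 * q) ^ 5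

{-# OPTIONS --safe #-}

-- Split the vertices into four parts of size m and consider the tuples (a , b , c , d) with one vertex in each
-- part, that is, copies of K₄.  Maker builds the six bipartite graphs one after the other, in the order
-- ad, bc, bd, ac, ab, cd, and after each stage keeps a family X of tuples whose edges of the types built so far
-- are all hers.  Within a stage she always claims a free pair contained in many tuples of the previous family
-- that are still admitted; a tuple is admitted while its projections to the pairs still to be built (and to some
-- triples) have degree below a cap in the new family.  Double counting shows that the caps exclude only a
-- fraction of the tuples.  They in turn bound the number of tuples on each pair, so that the pairs claimed by
-- either player, a small fraction of all pairs, spoil only a fraction of the tuples.  After five stages every
-- pair cd lies in at most one tuple of X, so more pairs cd complete a K₄ than are claimed in total, and Maker
-- takes a free one.
-- The only property of Breaker's play that is used is that he owns at most q times as many edges as Maker.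

module Submission where

open import Data.Bool using (Bool; true; false; T; _∧_; _∨_; not)
open import Data.Bool.Properties using (T-∧; T-∨)
open import Data.Empty as Empty using (⊥-elim)
open import Data.Fin as Fin using (Fin; zero; suc)
import Data.Fin.Properties as Fin
open import Data.Fin.Subset as Subset using (Subset; ∣_∣; ∁; _∪_; ⁅_⁆; ⊥) renaming (_∈_ to _∈ₛ_)
open import Data.Fin.Subset.Properties
  using (x∈p∪q⁻; x∈p∪q⁺; x∈⁅x⁆; x∈⁅y⁆⇒x≡y; ∉⊥; ∣⊥∣≡0; ∣∁p∣≡n∸∣p∣; ∣p∣≤n; ∪-identityˡ)
open import Data.List using (List; []; _∷_; _++_; length; map; concatMap; allFin; tabulate)
open import Data.List.Properties using (map-tabulate; length-tabulate; length-++)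
open import Data.List.Membership.Propositional using (_∈_; _∉_; find; lose)
open import Data.List.Membership.Propositional.Properties using (∈-allFin; ∈-concatMap⁺; ∈-++⁺ˡ; ∈-++⁺ʳ; ∈-++⁻)
open import Data.List.Relation.Binary.Subset.Propositional using (_⊆_)
open import Data.List.Relation.Unary.All as All using (All; []; _∷_)
open import Data.List.Relation.Unary.All.Properties using (¬All⇒Any¬)
open import Data.List.Relation.Unary.Any using (here; there)
open import Data.Nat
open import Data.Nat.Properties
open import Data.Nat.Tactic.RingSolver using (solve-∀)
open import Data.Product using (_×_; _,_; ∃-syntax; proj₁; proj₂)
open import Data.Sum using (_⊎_; inj₁; inj₂)
open import Data.Unit using (tt)
open import Data.Vec using (Vec; []; _∷_; lookup; _[_]≔_; here; there)
open import Data.Vec.Properties using (lookup∘update; lookup∘update′; []=⇒lookup; lookup⇒[]=)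
open import Function using (_∘_; Equivalence)
open import Relation.Nullary using (¬_; Dec; yes; no; does; contradiction)
open import Relation.Nullary.Decidable using (_⊎-dec_)
open import Relation.Binary.Definitions using (DecidableEquality; tri<; tri≈; tri>)
open import Relation.Binary.PropositionalEquality
open import Defs

private variable
  A B : Set

-- Finite sums

∑ : List A → (A → ℕ) → ℕ
∑ []       f = 0
∑ (x ∷ xs) f = f x + ∑ xs f

∑-cong : ∀ (xs : List A) {f g : A → ℕ} → (∀ x → f x ≡ g x) → ∑ xs f ≡ ∑ xs g
∑-cong []       f≡g = refl
∑-cong (x ∷ xs) f≡g = cong₂ _+_ (f≡g x) (∑-cong xs f≡g)

∑-mono : ∀ (xs : List A) {f g : A → ℕ} → (∀ x → f x ≤ g x) → ∑ xs f ≤ ∑ xs g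
∑-mono []       f≤g = z≤n
∑-mono (x ∷ xs) f≤g = +-mono-≤ (f≤g x) (∑-mono xs f≤g)

∑-mono-< : ∀ {xs : List A} {f g : A → ℕ} {x} → (∀ x → f x ≤ g x) → x ∈ xs → f x < g x →
           ∑ xs f < ∑ xs g
∑-mono-< {xs = _ ∷ xs} f≤g (here refl) fx<gx = +-mono-<-≤ fx<gx (∑-mono xs f≤g)
∑-mono-< {xs = y ∷ _}  f≤g (there x∈)  fx<gx = +-mono-≤-< (f≤g y) (∑-mono-< f≤g x∈ fx<gx)

∑-+ : ∀ (xs : List A) (f g : A → ℕ) → ∑ xs (λ x → f x + g x) ≡ ∑ xs f + ∑ xs g
∑-+ []       f g = refl
∑-+ (x ∷ xs) f g = begin
  f x + g x + ∑ xs (λ x → f x + g x)  ≡⟨ cong (f x + g x +_) (∑-+ xs f g) ⟩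
  f x + g x + (∑ xs f + ∑ xs g)       ≡⟨ +-assoc (f x) (g x) _ ⟩
  f x + (g x + (∑ xs f + ∑ xs g))     ≡⟨ cong (f x +_) (+-assoc (g x) _ _) ⟨
  f x + (g x + ∑ xs f + ∑ xs g)       ≡⟨ cong (λ z → f x + (z + ∑ xs g)) (+-comm (g x) _) ⟩
  f x + (∑ xs f + g x + ∑ xs g)       ≡⟨ cong (f x +_) (+-assoc (∑ xs f) _ _) ⟩
  f x + (∑ xs f + (g x + ∑ xs g))     ≡⟨ +-assoc (f x) _ _ ⟨
  f x + ∑ xs f + (g x + ∑ xs g)       ∎
  where open ≡-Reasoning

∑-*ʳ : ∀ (xs : List A) (f : A → ℕ) c → ∑ xs f * c ≡ ∑ xs (λ x → f x * c)
∑-*ʳ []       f c = refl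
∑-*ʳ (x ∷ xs) f c = trans (*-distribʳ-+ c (f x) _) (cong (f x * c +_) (∑-*ʳ xs f c))

∑-const : ∀ (xs : List A) c → ∑ xs (λ _ → c) ≡ length xs * c
∑-const []       c = refl
∑-const (x ∷ xs) c = cong (c +_) (∑-const xs c)

∑-swap : ∀ (xs : List A) (ys : List B) (f : A → B → ℕ) →
         ∑ xs (λ x → ∑ ys (f x)) ≡ ∑ ys (λ y → ∑ xs (λ x → f x y))
∑-swap []       ys f = sym (trans (∑-const ys 0) (*-zeroʳ (length ys)))
∑-swap (x ∷ xs) ys f = trans (cong (∑ ys (f x) +_) (∑-swap xs ys f))
                             (sym (∑-+ ys (f x) _))

∑-++ : ∀ (xs ys : List A) (f : A → ℕ) → ∑ (xs ++ ys) f ≡ ∑ xs f + ∑ ys f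
∑-++ []       ys f = refl
∑-++ (x ∷ xs) ys f = trans (cong (f x +_) (∑-++ xs ys f)) (sym (+-assoc (f x) _ _))

∑-map : ∀ (xs : List A) (g : A → B) (f : B → ℕ) → ∑ (map g xs) f ≡ ∑ xs (f ∘ g)
∑-map []       g f = refl
∑-map (x ∷ xs) g f = cong (f (g x) +_) (∑-map xs g f)

∑-concatMap : ∀ (xs : List A) (g : A → List B) (f : B → ℕ) →
              ∑ (concatMap g xs) f ≡ ∑ xs (λ x → ∑ (g x) f)
∑-concatMap []       g f = refl
∑-concatMap (x ∷ xs) g f = trans (∑-++ (g x) _ f) (cong (∑ (g x) f +_) (∑-concatMap xs g f))

∑-∈ : ∀ {xs : List A} {x} (f : A → ℕ) → x ∈ xs → f x ≤ ∑ xs f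
∑-∈ f (here refl) = m≤m+n _ _
∑-∈ f (there x∈)  = ≤-trans (∑-∈ f x∈) (m≤n+m _ _)

∑-large : ∀ (xs : List A) (f : A → ℕ) c → length xs * c < ∑ xs f → ∃[ x ] c < f x
∑-large (x ∷ xs) f c lt with f x ≤? c
... | no  fx≰c = x , ≰⇒> fx≰c
... | yes fx≤c = ∑-large xs f c (+-cancelˡ-< c _ _ (<-≤-trans lt (+-monoˡ-≤ _ fx≤c)))

-- Indicators of Booleans and of decidable propositions.

𝟙 : Bool → ℕ
𝟙 false = 0
𝟙 true  = 1

∧-intro : ∀ {a b} → T a → T b → T (a ∧ b)
∧-intro p q = Equivalence.from T-∧ (p , q)

∧-elim : ∀ a {b} → T (a ∧ b) → T a × T b
∧-elim a = Equivalence.to (T-∧ {a})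

∨-elim : ∀ a {b} → T (a ∨ b) → T a ⊎ T b
∨-elim a = Equivalence.to (T-∨ {a})

𝟙-split : ∀ a b c → (T a → T b ⊎ T c) → 𝟙 a ≤ 𝟙 b + 𝟙 c
𝟙-split false b     c     a⇒ = z≤n
𝟙-split true  true  c     a⇒ = s≤s z≤n
𝟙-split true  false true  a⇒ = ≤-refl
𝟙-split true  false false a⇒ with a⇒ tt
... | inj₁ ()
... | inj₂ ()

𝟙-disjoint : ∀ a b c → (T a → T c) → (T b → T c) → (T a → ¬ T b) → 𝟙 a + 𝟙 b ≤ 𝟙 c
𝟙-disjoint true  true  c     _   _   ¬b = ⊥-elim (¬b tt tt)
𝟙-disjoint true  false true  _   _   _  = ≤-refl
𝟙-disjoint true  false false a⇒c _   _  = ⊥-elim (a⇒c tt)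
𝟙-disjoint false true  true  _   _   _  = ≤-refl
𝟙-disjoint false true  false _   b⇒c _  = ⊥-elim (b⇒c tt)
𝟙-disjoint false false c     _   _   _  = z≤n

𝟙-mono : ∀ a b → (T a → T b) → 𝟙 a ≤ 𝟙 b
𝟙-mono false b     a⇒b = z≤n
𝟙-mono true  true  a⇒b = ≤-refl
𝟙-mono true  false a⇒b = ⊥-elim (a⇒b tt)

𝟙-∧ : ∀ a b → 𝟙 (a ∧ b) ≡ 𝟙 b * 𝟙 a
𝟙-∧ false b = sym (*-zeroʳ (𝟙 b))
𝟙-∧ true  b = sym (*-identityʳ (𝟙 b))

does-intro : ∀ {P : Set} (p? : Dec P) → P → T (does p?)
does-intro (yes _) p = tt
does-intro (no ¬p) p = ¬p p

does-elim : ∀ {P : Set} (p? : Dec P) → T (does p?) → P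
does-elim (yes p) _ = p

not-does-intro : ∀ {P : Set} (p? : Dec P) → ¬ P → T (not (does p?))
not-does-intro (yes p) ¬p = ¬p p
not-does-intro (no _)  ¬p = tt

not-does-elim : ∀ {P : Set} (p? : Dec P) → T (not (does p?)) → ¬ P
not-does-elim (no ¬p) _ = ¬p

𝟙-< : ∀ {a b} → ¬ T a → T b → 𝟙 a < 𝟙 b
𝟙-< {true}         ¬a _ = contradiction tt ¬a
𝟙-< {false} {true} ¬a _ = s≤s z≤n

0<𝟙⇒T : ∀ a → 0 < 𝟙 a → T a
0<𝟙⇒T true _ = tt

∑-tabulate-suc : ∀ {m} (f : Fin (suc m) → ℕ) → ∑ (tabulate Fin.suc) f ≡ ∑ (allFin m) (f ∘ Fin.suc)
∑-tabulate-suc {m} f =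
  trans (cong (λ ys → ∑ ys f) (sym (map-tabulate {n = m} (λ y → y) Fin.suc))) (∑-map (allFin m) suc f)

∑-allFin-≟ : ∀ {m} (x : Fin m) → ∑ (allFin m) (λ y → 𝟙 (does (x Fin.≟ y))) ≡ 1
∑-allFin-≟ {suc m} zero    = cong suc (trans (∑-tabulate-suc {m} _)
                               (trans (∑-const (allFin m) 0) (*-zeroʳ (length (allFin m)))))
∑-allFin-≟ {suc m} (suc x) = trans (∑-tabulate-suc {m} _) (∑-allFin-≟ x)

-- Counting tuples by degrees

module Tuples (m : ℕ) where

  length-allFin : length (allFin m) ≡ m
  length-allFin = length-tabulate {n = m} (λ y → y)

  tuples : ∀ k → List (Vec (Fin m) k)
  tuples zero    = [] ∷ []
  tuples (suc k) = concatMap (λ x → map (x ∷_) (tuples k)) (allFin m)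

  ∑-tuples : ∀ k (f : Vec (Fin m) (suc k) → ℕ) →
             ∑ (tuples (suc k)) f ≡ ∑ (allFin m) (λ x → ∑ (tuples k) (λ t → f (x ∷ t)))
  ∑-tuples k f = trans (∑-concatMap (allFin m) _ f)
                       (∑-cong (allFin m) (λ x → ∑-map (tuples k) (x ∷_) f))

  -- A Subset k serves as a mask: t and u are compared on the coordinates in M only.
  same : ∀ {k} → Subset k → (t u : Vec (Fin m) k) → Bool
  same []          []      []      = true
  same (false ∷ M) (x ∷ t) (y ∷ u) = same M t u
  same (true  ∷ M) (x ∷ t) (y ∷ u) = does (x Fin.≟ y) ∧ same M t u

  same⇒lookup≡ : ∀ {k} (M : Subset k) t u → T (same M t u) → ∀ {i} → i ∈ₛ M → lookup t i ≡ lookup u i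
  same⇒lookup≡ (true ∷ M)  (x ∷ t) (y ∷ u) s here with x Fin.≟ y
  ... | yes x≡y = x≡y
  same⇒lookup≡ (true ∷ M)  (x ∷ t) (y ∷ u) s (there i∈) =
    same⇒lookup≡ M t u (proj₂ (∧-elim (does (x Fin.≟ y)) s)) i∈
  same⇒lookup≡ (false ∷ M) (x ∷ t) (y ∷ u) s (there i∈) = same⇒lookup≡ M t u s i∈

  lookup≡⇒same : ∀ {k} (M : Subset k) t u → (∀ {i} → i ∈ₛ M → lookup t i ≡ lookup u i) → T (same M t u)
  lookup≡⇒same []          []      []      eq = tt
  lookup≡⇒same (true ∷ M)  (x ∷ t) (y ∷ u) eq with x Fin.≟ y
  ... | yes _   = lookup≡⇒same M t u (eq ∘ there)
  ... | no  x≢y = contradiction (eq here) x≢y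
  lookup≡⇒same (false ∷ M) (x ∷ t) (y ∷ u) eq = lookup≡⇒same M t u (eq ∘ there)

  same-sym : ∀ {k} (M : Subset k) t u → T (same M t u) → T (same M u t)
  same-sym M t u s = lookup≡⇒same M u t (λ i∈ → sym (same⇒lookup≡ M t u s i∈))

  same-trans : ∀ {k} (M : Subset k) t u v → T (same M t u) → T (same M u v) → T (same M t v)
  same-trans M t u v s s′ =
    lookup≡⇒same M t v (λ i∈ → trans (same⇒lookup≡ M t u s i∈) (same⇒lookup≡ M u v s′ i∈))

  same-∪ : ∀ {k} (M N : Subset k) t u → T (same M t u) → T (same N t u) → T (same (M ∪ N) t u)
  same-∪ M N t u s s′ = lookup≡⇒same (M ∪ N) t u λ i∈ → case′ (x∈p∪q⁻ M N i∈)
    where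
    case′ : ∀ {i} → i ∈ₛ M ⊎ i ∈ₛ N → lookup t i ≡ lookup u i
    case′ (inj₁ i∈M) = same⇒lookup≡ M t u s i∈M
    case′ (inj₂ i∈N) = same⇒lookup≡ N t u s′ i∈N

  count-same : ∀ {k} (M : Subset k) t → ∑ (tuples k) (λ u → 𝟙 (same M t u)) ≡ m ^ ∣ ∁ M ∣
  count-same []          []      = refl
  count-same {suc k} (false ∷ M) (x ∷ t) = begin
    ∑ (tuples (suc k)) (λ u → 𝟙 (same (false ∷ M) (x ∷ t) u))  ≡⟨ ∑-tuples k _ ⟩
    ∑ (allFin m) (λ _ → N)                                     ≡⟨ ∑-const (allFin m) _ ⟩
    length (allFin m) * N                                      ≡⟨ cong₂ _*_ length-allFin (count-same M t) ⟩
    m * m ^ ∣ ∁ M ∣                                            ∎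
    where
    open ≡-Reasoning
    N = ∑ (tuples k) (λ u → 𝟙 (same M t u))
  count-same {suc k} (true ∷ M) (x ∷ t) = begin
    ∑ (tuples (suc k)) (λ u → 𝟙 (same (true ∷ M) (x ∷ t) u))
      ≡⟨ ∑-tuples k _ ⟩
    ∑ (allFin m) (λ y → ∑ (tuples k) (λ u → 𝟙 (does (x Fin.≟ y) ∧ same M t u)))
      ≡⟨ ∑-cong (allFin m) (λ y → ∑-cong (tuples k) (λ u → 𝟙-∧ (does (x Fin.≟ y)) _)) ⟩
    ∑ (allFin m) (λ y → ∑ (tuples k) (λ u → 𝟙 (same M t u) * 𝟙 (does (x Fin.≟ y))))
      ≡⟨ ∑-cong (allFin m) (λ y → sym (∑-*ʳ (tuples k) _ _)) ⟩
    ∑ (allFin m) (λ y → N * 𝟙 (does (x Fin.≟ y)))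
      ≡⟨ ∑-cong (allFin m) (λ y → *-comm N _) ⟩
    ∑ (allFin m) (λ y → 𝟙 (does (x Fin.≟ y)) * N)
      ≡⟨ ∑-*ʳ (allFin m) _ _ ⟨
    ∑ (allFin m) (λ y → 𝟙 (does (x Fin.≟ y))) * N
      ≡⟨ cong₂ _*_ (∑-allFin-≟ x) (count-same M t) ⟩
    1 * m ^ ∣ ∁ M ∣
      ≡⟨ *-identityˡ _ ⟩
    m ^ ∣ ∁ M ∣ ∎
    where
    open ≡-Reasoning
    N = ∑ (tuples k) (λ u → 𝟙 (same M t u))

  length-tuples : ∀ k → length (tuples k) ≡ m ^ k
  length-tuples k = begin
    length (tuples k)                  ≡⟨ *-identityʳ _ ⟨
    length (tuples k) * 1              ≡⟨ ∑-const (tuples k) 1 ⟨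
    ∑ (tuples k) (λ _ → 1)             ≡⟨ go k ⟩
    m ^ k                              ∎
    where
    open ≡-Reasoning
    go : ∀ k → ∑ (tuples k) (λ _ → 1) ≡ m ^ k
    go zero    = refl
    go (suc k) = trans (∑-tuples k _) (trans (∑-const (allFin m) _)
                   (cong₂ _*_ length-allFin (go k)))

-- Families of tuples, their degrees and their growth.

module Families (m k : ℕ) where

  open Tuples m

  Tuple : Set
  Tuple = Vec (Fin m) k

  Family : Set
  Family = Tuple → Bool

  infix 4 _⊑_

  _⊑_ : Family → Family → Set
  X ⊑ Y = ∀ t → T (X t) → T (Y t)

  #_ : Family → ℕ
  # X = ∑ (tuples k) (𝟙 ∘ X)

  #-mono : ∀ {X Y} → X ⊑ Y → # X ≤ # Y
  #-mono X⊑Y = ∑-mono (tuples k) (λ t → 𝟙-mono _ _ (X⊑Y t))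

  #-split : ∀ {X} Y Z → (∀ t → T (X t) → T (Y t) ⊎ T (Z t)) → # X ≤ # Y + # Z
  #-split Y Z X⇒ = ≤-trans (∑-mono (tuples k) (λ t → 𝟙-split _ (Y t) (Z t) (X⇒ t)))
                           (≤-reflexive (∑-+ (tuples k) _ _))

  #-disjoint : ∀ {X Y Z} → X ⊑ Z → Y ⊑ Z → (∀ t → T (X t) → ¬ T (Y t)) → # X + # Y ≤ # Z
  #-disjoint {X} {Y} {Z} X⊑Z Y⊑Z X#Y = ≤-trans (≤-reflexive (sym (∑-+ (tuples k) _ _)))
    (∑-mono (tuples k) (λ t → 𝟙-disjoint (X t) (Y t) (Z t) (X⊑Z t) (Y⊑Z t) (X#Y t)))

  #-inhabited : ∀ {X} → 0 < # X → ∃[ t ] T (X t)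
  #-inhabited {X} 0<#X
    with ∑-large (tuples k) _ 0 (≤-trans (s≤s (≤-reflexive (*-zeroʳ (length (tuples k))))) 0<#X)
  ... | t , 0<𝟙 = t , 0<𝟙⇒T (X t) 0<𝟙

  #-bound : ∀ {X c} → (∀ t → T (X t) → # X ≤ c) → # X ≤ c
  #-bound {X} bound with # X in eq
  ... | zero  = z≤n
  ... | suc a with #-inhabited {X} (subst (0 <_) (sym eq) (s≤s z≤n))
  ...   | t , Xt = bound t Xt

  deg : Family → Subset k → Tuple → ℕ
  deg X M t = # (λ u → X u ∧ same M t u)

  record DegreesAtMost (c : ℕ) (M : Subset k) (X : Family) : Set where
    constructor degrees≤
    field degree≤ : ∀ t → deg X M t ≤ c

  open DegreesAtMost

  deg-⊑ : ∀ {X Y} → X ⊑ Y → ∀ M t → deg X M t ≤ deg Y M t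
  deg-⊑ {X} X⊑Y M t = #-mono λ u p → let Xu , s = ∧-elim (X u) p in ∧-intro (X⊑Y u Xu) s

  degrees-⊑ : ∀ {X Y M c} → X ⊑ Y → DegreesAtMost c M Y → DegreesAtMost c M X
  degrees-⊑ {M = M} X⊑Y d = degrees≤ λ t → ≤-trans (deg-⊑ X⊑Y M t) (degree≤ d t)

  degrees-≤ : ∀ {X M c d} → c ≤ d → DegreesAtMost c M X → DegreesAtMost d M X
  degrees-≤ c≤d b = degrees≤ λ t → ≤-trans (degree≤ b t) c≤d

  degrees-free : ∀ X M → DegreesAtMost (m ^ ∣ ∁ M ∣) M X
  degrees-free X M = degrees≤ λ t → ≤-trans (#-mono (λ u p → proj₂ (∧-elim (X u) p)))
                                            (≤-reflexive (count-same M t))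

  -- Splitting by the value of coordinate `i` turns a class into `m` classes of the finer mask. This
  -- is how degrees of pairs are bounded by degrees of triples.
  degrees-forget : ∀ {X M c} i → DegreesAtMost c (M [ i ]≔ true) X → DegreesAtMost (m * c) M X
  degrees-forget {X} {M} {c} i d = degrees≤ λ t → begin
    # (λ u → X u ∧ same M t u)
      ≤⟨ ∑-mono (tuples k) (λ u → ≤-trans (𝟙-mono _ _ (refine t u))
           (∑-∈ (λ x → 𝟙 (X u ∧ same M⁺ (t [ i ]≔ x) u)) (∈-allFin (lookup u i)))) ⟩
    ∑ (tuples k) (λ u → ∑ (allFin m) (λ x → 𝟙 (X u ∧ same M⁺ (t [ i ]≔ x) u)))
      ≡⟨ ∑-swap (tuples k) (allFin m) _ ⟩
    ∑ (allFin m) (λ x → deg X M⁺ (t [ i ]≔ x))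
      ≤⟨ ∑-mono (allFin m) (λ x → degree≤ d (t [ i ]≔ x)) ⟩
    ∑ (allFin m) (λ _ → c)
      ≡⟨ ∑-const (allFin m) c ⟩
    length (allFin m) * c
      ≡⟨ cong (_* c) length-allFin ⟩
    m * c ∎
    where
    open ≤-Reasoning
    M⁺ = M [ i ]≔ true
    refine : ∀ t u → T (X u ∧ same M t u) → T (X u ∧ same M⁺ (t [ i ]≔ lookup u i) u)
    refine t u p = ∧-intro Xu (lookup≡⇒same M⁺ _ u agree)
      where
      Xu = proj₁ (∧-elim (X u) p)
      s  = proj₂ (∧-elim (X u) p)
      agree : ∀ {j} → j ∈ₛ M⁺ → lookup (t [ i ]≔ lookup u i) j ≡ lookup u j
      agree {j} j∈ with j Fin.≟ i
      ... | yes refl = lookup∘update i t _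
      ... | no  j≢i  = trans (lookup∘update′ j≢i t _)
                         (same⇒lookup≡ M t u s
                           (lookup⇒[]= j M (trans (sym (lookup∘update′ j≢i M true)) ([]=⇒lookup j∈))))

  -- Double counting of the pairs (t , u) ∈ X × Y that agree on M.
  saturated-count : ∀ X Y M c d → DegreesAtMost d M X →
                    # (λ t → X t ∧ (c ≤ᵇ deg Y M t)) * c ≤ # Y * d
  saturated-count X Y M c d bound = begin
    # (λ t → X t ∧ (c ≤ᵇ deg Y M t)) * c
      ≡⟨ ∑-*ʳ (tuples k) _ c ⟩
    ∑ (tuples k) (λ t → 𝟙 (X t ∧ (c ≤ᵇ deg Y M t)) * c)
      ≤⟨ ∑-mono (tuples k) at-X ⟩
    ∑ (tuples k) (λ t → # (λ u → X t ∧ (Y u ∧ same M t u)))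
      ≡⟨ ∑-swap (tuples k) (tuples k) _ ⟩
    ∑ (tuples k) (λ u → # (λ t → X t ∧ (Y u ∧ same M t u)))
      ≤⟨ ∑-mono (tuples k) at-Y ⟩
    ∑ (tuples k) (λ u → 𝟙 (Y u) * d)
      ≡⟨ ∑-*ʳ (tuples k) _ d ⟨
    # Y * d ∎
    where
    open ≤-Reasoning
    at-X : ∀ t → 𝟙 (X t ∧ (c ≤ᵇ deg Y M t)) * c ≤ # (λ u → X t ∧ (Y u ∧ same M t u))
    at-X t with X t
    ... | false = z≤n
    ... | true  with c ≤ᵇ deg Y M t in eq
    ...   | false = z≤n
    ...   | true  = ≤-trans (≤-reflexive (*-identityˡ c)) (≤ᵇ⇒≤ c _ (subst T (sym eq) tt))
    at-Y : ∀ u → # (λ t → X t ∧ (Y u ∧ same M t u)) ≤ 𝟙 (Y u) * d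
    at-Y u with Y u
    ... | true  = begin
      # (λ t → X t ∧ same M t u)  ≤⟨ #-mono (λ t p → let Xt , s = ∧-elim (X t) p in
                                               ∧-intro Xt (same-sym M t u s)) ⟩
      deg X M u                   ≤⟨ degree≤ bound u ⟩
      d                           ≡⟨ *-identityˡ d ⟨
      1 * d                       ∎
    ... | false = #-bound λ t p → contradiction (proj₂ (∧-elim (X t) p)) (λ ())

  -- Averaging over all `m ^ k` tuples: every member of `X` is counted in the degree of each tuple
  -- that agrees with it on `M`, hence `m ^ ∣ ∁ M ∣` times.
  large-degree : ∀ .{{_ : NonZero m}} X M c → m ^ k * c < # X * m ^ ∣ ∁ M ∣ → ∃[ t ] c < deg X M t
  large-degree X M c lt = ∑-large (tuples k) (deg X M) c (begin-strict
    length (tuples k) * c                                   ≡⟨ cong (_* c) (length-tuples k) ⟩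
    m ^ k * c                                               <⟨ lt ⟩
    # X * m ^ ∣ ∁ M ∣                                       ≡⟨ ∑-*ʳ (tuples k) _ _ ⟩
    ∑ (tuples k) (λ t → 𝟙 (X t) * m ^ ∣ ∁ M ∣)              ≤⟨ ∑-mono (tuples k) at ⟩
    ∑ (tuples k) (λ t → # (λ u → X t ∧ same M u t))         ≡⟨ ∑-swap (tuples k) (tuples k) _ ⟩
    ∑ (tuples k) (deg X M)                                  ∎)
    where
    open ≤-Reasoning
    at : ∀ t → 𝟙 (X t) * m ^ ∣ ∁ M ∣ ≤ # (λ u → X t ∧ same M u t)
    at t with X t
    ... | false = z≤n
    ... | true  = begin
      1 * m ^ ∣ ∁ M ∣       ≡⟨ *-identityˡ _ ⟩
      m ^ ∣ ∁ M ∣           ≡⟨ count-same M t ⟨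
      # (same M t)          ≤⟨ #-mono (λ u → same-sym M t u) ⟩
      # (λ u → same M u t)  ∎

  -- A tuple is admitted to a growing family only while its projection to mask has degree below cap there;
  -- since one move raises a degree by at most slack, degrees stay at most new.  Here old bounds the degrees in
  -- the family the tuples are taken from, and lost the number of tuples that are not admitted.
  record Constraint : Set where
    constructor constraint
    field
      mask : Subset k
      old cap slack new lost : ℕ

  open Constraint

  -- One move adds tuples that agree on `E`; those that also agree on the mask share a class of
  -- `E ∪ mask κ`, whence the mask of the slack. A degree below the cap is at most one less than it,
  -- which accounts for the `suc` in `cap+slack≤new`. `goal*old≤lost` turns `saturated-count` into
  -- the bound `lost` as long as the new family has at most `goal` tuples.
  record Admissible (X : Family) (E : Subset k) (goal : ℕ) (κ : Constraint) : Set where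
    constructor admissible
    field
      old-degrees   : DegreesAtMost (old κ) (mask κ) X
      slack-degrees : DegreesAtMost (slack κ) (E ∪ mask κ) X
      cap+slack≤new : cap κ + slack κ ≤ suc (new κ)
      goal*old≤lost : goal * old κ ≤ lost κ * cap κ
      cap≢0         : NonZero (cap κ)

  open Admissible

  unsaturated : Family → Constraint → Family
  unsaturated Y κ t = not (cap κ ≤ᵇ deg Y (mask κ) t)

  admitted : Family → List Constraint → Family
  admitted Y []       t = true
  admitted Y (κ ∷ κs) t = unsaturated Y κ t ∧ admitted Y κs t

  admitted-all : ∀ Y κs {t κ} → T (admitted Y κs t) → κ ∈ κs → T (unsaturated Y κ t)
  admitted-all Y (κ ∷ κs) {t} a (here refl) = proj₁ (∧-elim (unsaturated Y κ t) a)
  admitted-all Y (κ ∷ κs) {t} a (there κ∈)  = admitted-all Y κs (proj₂ (∧-elim (unsaturated Y κ t) a)) κ∈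

  T⊎Tnot : ∀ b → T b ⊎ T (not b)
  T⊎Tnot true  = inj₁ tt
  T⊎Tnot false = inj₂ tt

  Tnot⇒¬T : ∀ {b} → T (not b) → ¬ T b
  Tnot⇒¬T {false} _ ()

  -- By induction on the constraints: each further one removes only saturated tuples, and
  -- `saturated-count` with `# Y ≤ goal` bounds their number by `lost κ`.
  few-saturated : ∀ {X Y E goal} κs → All (Admissible X E goal) κs → # Y ≤ goal →
                  # X ≤ # (λ t → X t ∧ admitted Y κs t) + ∑ κs lost
  few-saturated {X} {Y} [] [] _ = ≤-trans (#-mono (λ t Xt → ∧-intro Xt tt)) (m≤m+n _ 0)
  few-saturated {X} {Y} {goal = goal} (κ ∷ κs) (α ∷ αs) #Y≤ = begin
    # X                                          ≤⟨ few-saturated κs αs #Y≤ ⟩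
    # (λ t → X t ∧ admitted Y κs t) + ∑ κs lost  ≤⟨ +-monoˡ-≤ _ (#-split remaining saturated split) ⟩
    # remaining + # saturated + ∑ κs lost        ≡⟨ +-assoc (# remaining) (# saturated) _ ⟩
    # remaining + (# saturated + ∑ κs lost)      ≤⟨ +-monoʳ-≤ (# remaining) (+-monoˡ-≤ _ few) ⟩
    # remaining + ∑ (κ ∷ κs) lost                ∎
    where
    open ≤-Reasoning
    remaining : Family
    remaining t = X t ∧ admitted Y (κ ∷ κs) t
    saturated : Family
    saturated t = X t ∧ (cap κ ≤ᵇ deg Y (mask κ) t)
    split : ∀ t → T (X t ∧ admitted Y κs t) → T (remaining t) ⊎ T (saturated t)
    split t p with ∧-elim (X t) p | T⊎Tnot (cap κ ≤ᵇ deg Y (mask κ) t)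
    ... | Xt , _ | inj₁ sat   = inj₂ (∧-intro Xt sat)
    ... | Xt , a | inj₂ unsat = inj₁ (∧-intro Xt (∧-intro unsat a))
    few : # saturated ≤ lost κ
    few = *-cancelʳ-≤ _ _ (cap κ) {{cap≢0 α}} (begin
      # saturated * cap κ  ≤⟨ saturated-count X Y (mask κ) (cap κ) (old κ) (old-degrees α) ⟩
      # Y * old κ          ≤⟨ *-monoˡ-≤ (old κ) #Y≤ ⟩
      goal * old κ         ≤⟨ goal*old≤lost α ⟩
      lost κ * cap κ       ∎)

  -- If no member of `Z` agrees with `t` on the mask, the degree at `t` is unchanged. Otherwise such
  -- a member `t₁` has the same degree in `Y` as `t`, and this is below the cap since `t₁` is
  -- unsaturated; the members of `Z` that count lie in the class of `t₁` for `E ∪ M`, so they number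
  -- at most the slack.
  adjoin-degrees : ∀ {X Y Z E goal κ} t₀ → Admissible X E goal κ →
    Z ⊑ X → (∀ t → T (Z t) → T (same E t₀ t)) → (∀ t → T (Z t) → T (unsaturated Y κ t)) →
    DegreesAtMost (new κ) (mask κ) Y → DegreesAtMost (new κ) (mask κ) (λ t → Y t ∨ Z t)
  adjoin-degrees {X} {Y} {Z} {E} {κ = κ} t₀ α Z⊑X Z-same Z-unsat Y-bound =
    degrees≤ λ t → ≤-trans (split t) (bound t)
    where
    open ≤-Reasoning
    M = mask κ
    split : ∀ t → deg (λ u → Y u ∨ Z u) M t ≤ deg Y M t + deg Z M t
    split t = #-split _ _ λ u p → let YZ , s = ∧-elim (Y u ∨ Z u) p in distribute u s (∨-elim (Y u) YZ)
      where
      distribute : ∀ u → T (same M t u) → T (Y u) ⊎ T (Z u) →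
                   T (Y u ∧ same M t u) ⊎ T (Z u ∧ same M t u)
      distribute u s (inj₁ Yu) = inj₁ (∧-intro Yu s)
      distribute u s (inj₂ Zu) = inj₂ (∧-intro Zu s)
    bound : ∀ t → deg Y M t + deg Z M t ≤ new κ
    bound t with deg Z M t in eq
    ... | zero  = ≤-trans (≤-reflexive (+-identityʳ _)) (degree≤ Y-bound t)
    ... | suc a with #-inhabited {λ u → Z u ∧ same M t u} (subst (0 <_) (sym eq) (s≤s z≤n))
    ...   | t₁ , p = s≤s⁻¹ (begin
      suc (deg Y M t) + suc a    ≤⟨ +-monoˡ-≤ (suc a) below-cap ⟩
      cap κ + suc a              ≡⟨ cong (cap κ +_) eq ⟨
      cap κ + deg Z M t          ≤⟨ +-monoʳ-≤ (cap κ) (#-mono Z⇒) ⟩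
      cap κ + deg X (E ∪ M) t₁   ≤⟨ +-monoʳ-≤ (cap κ) (degree≤ (slack-degrees α) t₁) ⟩
      cap κ + slack κ            ≤⟨ cap+slack≤new α ⟩
      suc (new κ)                ∎)
      where
      Zt₁ = proj₁ (∧-elim (Z t₁) p)
      t~t₁ : T (same M t t₁)
      t~t₁ = proj₂ (∧-elim (Z t₁) p)
      t₁~t = same-sym M t t₁ t~t₁
      Y-cap : cap κ ≤ deg Y M t → cap κ ≤ deg Y M t₁
      Y-cap c≤ = ≤-trans c≤ (#-mono λ u q → let Yu , s = ∧-elim (Y u) q in
                                ∧-intro Yu (same-trans M t₁ t u t₁~t s))
      below-cap : deg Y M t < cap κ
      below-cap = ≰⇒> (Tnot⇒¬T (Z-unsat t₁ Zt₁) ∘ ≤⇒≤ᵇ ∘ Y-cap)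
      Z⇒ : ∀ u → T (Z u ∧ same M t u) → T (X u ∧ same (E ∪ M) t₁ u)
      Z⇒ u q with ∧-elim (Z u) q
      ... | Zu , s = ∧-intro (Z⊑X u Zu) (same-∪ E M t₁ u
        (same-trans E t₁ t₀ u (same-sym E t₀ t₁ (Z-same t₁ Zt₁)) (Z-same u Zu))
        (same-trans M t₁ t u t₁~t s))

  -- In the application `key` is the edge of Kₙ that a tuple determines on the two coordinates in
  -- `E`. Claiming it secures a whole class of `E` at once.
  module Key {K : Set} (_≟_ : DecidableEquality K) (E : Subset k) (key : Tuple → K)
             (same⇒≡ : ∀ {t u} → T (same E t u) → key t ≡ key u)
             (≡⇒same : ∀ {t u} → key t ≡ key u → T (same E t u)) where

    open import Data.List.Membership.DecPropositional _≟_ using (_∈?_)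

    taken : List K → Family
    taken xs t = does (key t ∈? xs)

    -- Union bound over `xs`: the tuples of `X` with one given key lie in a single class of `E`.
    few-taken : ∀ {X d} xs → DegreesAtMost d E X → # (λ t → X t ∧ taken xs t) ≤ length xs * d
    few-taken {X} []       bound = #-bound λ t p → contradiction (proj₂ (∧-elim (X t) p)) (λ ())
    few-taken {X} {d} (x ∷ xs) bound =
      ≤-trans (#-split at-x _ split) (+-mono-≤ (#-bound at-x≤) (few-taken xs bound))
      where
      at-x : Family
      at-x t = X t ∧ does (key t ≟ x)
      split : ∀ t → T (X t ∧ taken (x ∷ xs) t) → T (at-x t) ⊎ T (X t ∧ taken xs t)
      split t p with ∧-elim (X t) p
      ... | Xt , q with does-elim (key t ∈? (x ∷ xs)) q
      ...   | here eq   = inj₁ (∧-intro Xt (does-intro (key t ≟ x) eq))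
      ...   | there ∈xs = inj₂ (∧-intro Xt (does-intro (key t ∈? xs) ∈xs))
      at-x≤ : ∀ t → T (at-x t) → # at-x ≤ d
      at-x≤ t p = ≤-trans
        (#-mono λ u q → let Xu , eq = ∧-elim (X u) q in
          ∧-intro Xu (≡⇒same (trans (does-elim (key t ≟ x) (proj₂ (∧-elim (X t) p)))
                                    (sym (does-elim (key u ≟ x) eq)))))
        (degree≤ bound t)

    record Extension (X Y : Family) (κs : List Constraint) (gain : ℕ) (xs : List K) : Set where
      field
        tuple   : Tuple
        fresh   : key tuple ∉ xs
        family  : Family
        inside  : family ⊑ X
        keys    : ∀ t → T (family t) → T (Y t) ⊎ key t ≡ key tuple
        grown   : # Y + gain ≤ # family
        degrees : ∀ {κ} → κ ∈ κs → DegreesAtMost (new κ) (mask κ) family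

    extend : ∀ .{{_ : NonZero m}} {X Y goal d c gain xs κs} →
             All (Admissible X E goal) κs → DegreesAtMost d E X →
             Y ⊑ X → (∀ t → T (Y t) → key t ∈ xs) → # Y ≤ goal →
             (∀ {κ} → κ ∈ κs → DegreesAtMost (new κ) (mask κ) Y) →
             length xs ≤ c → m ^ ∣ E ∣ * gain + (∑ κs lost + c * d) < # X →
             Extension X Y κs (suc gain) xs
    extend {X} {Y} {goal} {d} {c} {gain} {xs} {κs} αs E-bound Y⊑X Y-keys #Y≤ Y-bounds |xs|≤c room = record
      { tuple   = t₀
      -- Averaging need not return an available tuple; `t₁` is an available one with the same key.
      ; fresh   = λ t₀∈ → available-fresh t₁ (proj₁ t₁-spec) (subst (_∈ xs) (same⇒≡ (proj₂ t₁-spec)) t₀∈)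
      ; family  = λ t → Y t ∨ Z t
      ; inside  = λ t p → union-case t (∨-elim (Y t) p)
      ; keys    = λ t p → union-keys t (∨-elim (Y t) p)
      ; grown   = ≤-trans (+-monoʳ-≤ (# Y) large)
                    (#-disjoint (λ t Yt → Equivalence.from T-∨ (inj₁ Yt))
                                (λ t Zt → Equivalence.from (T-∨ {Y t}) (inj₂ Zt))
                                (λ t Yt Zt → available-fresh t (proj₁ (∧-elim (available t) Zt)) (Y-keys t Yt)))
      ; degrees = λ κ∈ → adjoin-degrees {Y = Y} {Z = Z} t₀ (All.lookup αs κ∈)
                    (λ t Zt → available⊑X t (proj₁ (∧-elim (available t) Zt)))
                    (λ t Zt → proj₂ (∧-elim (available t) Zt))
                    (λ t Zt → admitted-all Y κs (available-admitted t (proj₁ (∧-elim (available t) Zt))) κ∈)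
                    (Y-bounds κ∈)
      }
      where
      open ≤-Reasoning
      available : Family
      available t = (X t ∧ admitted Y κs t) ∧ not (taken xs t)
      available⊑X : available ⊑ X
      available⊑X t p = proj₁ (∧-elim (X t) (proj₁ (∧-elim (X t ∧ admitted Y κs t) p)))
      available-admitted : ∀ t → T (available t) → T (admitted Y κs t)
      available-admitted t p = proj₂ (∧-elim (X t) (proj₁ (∧-elim (X t ∧ admitted Y κs t) p)))
      available-fresh : ∀ t → T (available t) → key t ∉ xs
      available-fresh t p t∈ = Tnot⇒¬T (proj₂ (∧-elim (X t ∧ admitted Y κs t) p)) (does-intro (key t ∈? xs) t∈)
      blocked = λ t → X t ∧ taken xs t
      split : ∀ t → T (X t ∧ admitted Y κs t) → T (available t) ⊎ T (blocked t)
      split t p with T⊎Tnot (taken xs t)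
      ... | inj₁ q = inj₂ (∧-intro (proj₁ (∧-elim (X t) p)) q)
      ... | inj₂ q = inj₁ (∧-intro p q)
      many : # X ≤ # available + (∑ κs lost + c * d)
      many = begin
        # X                                              ≤⟨ few-saturated κs αs #Y≤ ⟩
        # (λ t → X t ∧ admitted Y κs t) + ∑ κs lost      ≤⟨ +-monoˡ-≤ _ (#-split available blocked split) ⟩
        # available + # blocked + ∑ κs lost              ≡⟨ +-assoc (# available) _ _ ⟩
        # available + (# blocked + ∑ κs lost)            ≡⟨ cong (# available +_) (+-comm (# blocked) _) ⟩
        # available + (∑ κs lost + # blocked)            ≤⟨ +-monoʳ-≤ (# available) (+-monoʳ-≤ (∑ κs lost)
                                                              (≤-trans (few-taken xs E-bound) (*-monoˡ-≤ d |xs|≤c))) ⟩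
        # available + (∑ κs lost + c * d)                ∎
      room′ : m ^ ∣ E ∣ * gain < # available
      room′ = +-cancelʳ-< (∑ κs lost + c * d) _ _ (<-≤-trans room many)
      powers : m ^ k ≡ m ^ ∣ ∁ E ∣ * m ^ ∣ E ∣
      powers = trans
        (cong (m ^_) (sym (trans (cong (_+ ∣ E ∣) (∣∁p∣≡n∸∣p∣ E)) (m∸n+n≡m (∣p∣≤n E)))))
        (^-distribˡ-+-* m ∣ ∁ E ∣ ∣ E ∣)
      -- `large-degree` averages over tuples, not over classes, so both sides carry the class size
      -- `m ^ ∣ ∁ E ∣`.
      found : ∃[ t ] gain < deg available E t
      found = large-degree available E gain (begin-strict
        m ^ k * gain                           ≡⟨ cong (_* gain) powers ⟩
        m ^ ∣ ∁ E ∣ * m ^ ∣ E ∣ * gain         ≡⟨ *-assoc (m ^ ∣ ∁ E ∣) _ _ ⟩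
        m ^ ∣ ∁ E ∣ * (m ^ ∣ E ∣ * gain)       <⟨ *-monoʳ-< (m ^ ∣ ∁ E ∣) {{m^n≢0 m ∣ ∁ E ∣}} room′ ⟩
        m ^ ∣ ∁ E ∣ * # available              ≡⟨ *-comm (m ^ ∣ ∁ E ∣) _ ⟩
        # available * m ^ ∣ ∁ E ∣              ∎)
      t₀ = proj₁ found
      Z : Family
      Z t = available t ∧ same E t₀ t
      large : suc gain ≤ # Z
      large = proj₂ found
      witness : ∃[ t ] T (Z t)
      witness = #-inhabited {Z} (≤-trans (s≤s z≤n) large)
      t₁ = proj₁ witness
      t₁-spec : T (available t₁) × T (same E t₀ t₁)
      t₁-spec = ∧-elim (available t₁) (proj₂ witness)
      union-case : ∀ t → T (Y t) ⊎ T (Z t) → T (X t)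
      union-case t (inj₁ Yt) = Y⊑X t Yt
      union-case t (inj₂ Zt) = available⊑X t (proj₁ (∧-elim (available t) Zt))
      union-keys : ∀ t → T (Y t) ⊎ T (Z t) → T (Y t) ⊎ key t ≡ key t₀
      union-keys t (inj₁ Yt) = inj₁ Yt
      union-keys t (inj₂ Zt) = inj₂ (sym (same⇒≡ (proj₂ (∧-elim (available t) Zt))))

-- Plays

edge-≡ : ∀ {n} {e f : Edge n} → lo e ≡ lo f → hi e ≡ hi f → e ≡ f
edge-≡ {e = edge _ _ p} {f = edge _ _ q} refl refl = cong (edge _ _) (<-irrelevant p q)

infix 4 _≟ᴱ_

_≟ᴱ_ : ∀ {n} → DecidableEquality (Edge n)
e ≟ᴱ f with lo e Fin.≟ lo f | hi e Fin.≟ hi f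
... | yes l | yes h = yes (edge-≡ l h)
... | no  l | _     = no λ { refl → l refl }
... | _     | no  h = no λ { refl → h refl }

edgesBetween : ∀ {n} (i j : Fin n) → List (Edge n)
edgesBetween i j with i Fin.<? j
... | yes i<j = edge i j i<j ∷ []
... | no  _   = []

allEdges : ∀ n → List (Edge n)
allEdges n = concatMap (λ i → concatMap (edgesBetween i) (allFin n)) (allFin n)

∈-edgesBetween : ∀ {n} (e : Edge n) → e ∈ edgesBetween (lo e) (hi e)
∈-edgesBetween e with lo e Fin.<? hi e
... | yes _  = here (edge-≡ refl refl)
... | no  ≮  = contradiction (lo<hi e) ≮

∈-allEdges : ∀ {n} (e : Edge n) → e ∈ allEdges n
∈-allEdges e = ∈-concatMap⁺ _ (lose (∈-allFin (lo e))
                 (∈-concatMap⁺ _ (lose (∈-allFin (hi e)) (∈-edgesBetween e))))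

∣⁅x⁆∪p∣ : ∀ {n} {x : Fin n} {p : Subset n} → x Subset.∉ p → ∣ ⁅ x ⁆ ∪ p ∣ ≡ suc ∣ p ∣
∣⁅x⁆∪p∣ {x = zero}  {false ∷ p} x∉ = cong (λ r → suc ∣ r ∣) (∪-identityˡ p)
∣⁅x⁆∪p∣ {x = zero}  {true  ∷ p} x∉ = contradiction here x∉
∣⁅x⁆∪p∣ {x = suc x} {false ∷ p} x∉ = ∣⁅x⁆∪p∣ (x∉ ∘ there)
∣⁅x⁆∪p∣ {x = suc x} {true  ∷ p} x∉ = cong suc (∣⁅x⁆∪p∣ (x∉ ∘ there))

image : ∀ {k n} → (Fin k → Fin n) → Subset n
image {zero}  v = ⊥
image {suc k} v = ⁅ v zero ⁆ ∪ image (v ∘ suc)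

∈-image⁻ : ∀ {k n} (v : Fin k → Fin n) {x} → x ∈ₛ image v → ∃[ i ] x ≡ v i
∈-image⁻ {zero}  v x∈ = contradiction x∈ ∉⊥
∈-image⁻ {suc k} v x∈ with x∈p∪q⁻ ⁅ v zero ⁆ (image (v ∘ suc)) x∈
... | inj₁ x∈₀ = zero , x∈⁅y⁆⇒x≡y (v zero) x∈₀
... | inj₂ x∈₊ with ∈-image⁻ (v ∘ suc) x∈₊
...   | i , x≡ = suc i , x≡

∣image∣ : ∀ {k n} (v : Fin k → Fin n) → (∀ {i j} → i Fin.< j → v i Fin.< v j) → ∣ image v ∣ ≡ k
∣image∣ {zero}  {n} v v-mono = ∣⊥∣≡0 n
∣image∣ {suc k} v v-mono = trans (∣⁅x⁆∪p∣ v₀∉) (cong suc (∣image∣ (v ∘ suc) (v-mono ∘ s≤s)))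
  where
  v₀∉ : v zero Subset.∉ image (v ∘ suc)
  v₀∉ v₀∈ with ∈-image⁻ (v ∘ suc) v₀∈
  ... | i , v₀≡ = <-irrefl (cong Fin.toℕ v₀≡) (v-mono {zero} {suc i} (s≤s z≤n))

-- Winning strategies of Breaker exclude a K₄ of Maker.

module _ {n : ℕ} {rule : Rule n} {σ : Strategy n} (winning : IsWinning rule σ) where

  open import Data.List.Membership.DecPropositional (_≟ᴱ_ {n}) using (_∈?_)

  claims-disjoint : ∀ {ms e} → Play σ ms → e ∈ ms → e ∉ breakerEdges σ ms
  claims-disjoint {m ∷ ms} p@(move p′ (_ , m∉B)) e∈ms e∈B with ∈-++⁻ (σ (m ∷ ms)) e∈B
  claims-disjoint {m ∷ ms} p@(move p′ (_ , m∉B)) e∈ms e∈B | inj₁ e∈R =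
    proj₁ (All.lookup (proj₁ (proj₂ (proj₁ winning p))) e∈R) e∈ms
  claims-disjoint {m ∷ ms} (move p′ (_ , m∉B)) (here refl)   e∈B | inj₂ e∈B′ = m∉B e∈B′
  claims-disjoint {m ∷ ms} (move p′ (_ , m∉B)) (there e∈ms)  e∈B | inj₂ e∈B′ = claims-disjoint p′ e∈ms e∈B′

  -- The termination measure of `completePlay`.
  missing : List (Edge n) → ℕ
  missing ms = ∑ (allEdges n) (λ e → 𝟙 (not (does (e ∈? ms))))

  missing-∷ : ∀ {m ms} → m ∉ ms → missing (m ∷ ms) < missing ms
  missing-∷ {m} {ms} m∉ = ∑-mono-< {xs = allEdges n} weaken (∈-allEdges m) strict
    where
    weaken : ∀ e → 𝟙 (not (does (e ∈? (m ∷ ms)))) ≤ 𝟙 (not (does (e ∈? ms)))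
    weaken e = 𝟙-mono _ _ λ p → not-does-intro (e ∈? ms) (not-does-elim (e ∈? (m ∷ ms)) p ∘ there)
    strict : 𝟙 (not (does (m ∈? (m ∷ ms)))) < 𝟙 (not (does (m ∈? ms)))
    strict = 𝟙-< (λ p → not-does-elim (m ∈? (m ∷ ms)) p (here refl)) (not-does-intro (m ∈? ms) m∉)

  -- The winning condition concerns only plays in which every edge is claimed, so Maker goes on
  -- taking arbitrary free edges. At `r = 0` she owns every edge, and none can be free.
  completePlay : ∀ r {ms} → missing ms ≤ r → Play σ ms →
                 ∃[ ms′ ] Play σ ms′ × ms ⊆ ms′ × AllClaimed ms′ (breakerEdges σ ms′)
  completePlay r {ms} missing≤r p with All.all? (λ e → (e ∈? ms) ⊎-dec (e ∈? breakerEdges σ ms)) (allEdges n)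
  ... | yes all = ms , p , (λ e∈ → e∈) , λ e → All.lookup all (∈-allEdges e)
  ... | no ¬all with find (¬All⇒Any¬ (λ e → (e ∈? ms) ⊎-dec (e ∈? breakerEdges σ ms)) (allEdges n) ¬all)
  completePlay zero {ms} missing≤r p | no _ | m , m∈ , free =
    contradiction (≤-trans (∑-∈ _ m∈) missing≤r)
                  (<⇒≱ (𝟙-< {false} (λ ()) (not-does-intro (m ∈? ms) (free ∘ inj₁))))
  completePlay (suc r) {ms} missing≤r p | no _ | m , m∈ , free
    with completePlay r (s≤s⁻¹ (≤-trans (missing-∷ (free ∘ inj₁)) missing≤r))
                        (move p (free ∘ inj₁ , free ∘ inj₂))
  ... | ms′ , p′ , ⊆′ , all = ms′ , p′ , (λ e∈ → ⊆′ (there e∈)) , all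

  -- In the completed play Breaker owns an edge inside `image v`. Its ends are values of `v`, so it
  -- is one of the clique edges of Maker, against `claims-disjoint`.
  no-K₄ : ∀ {ms} → Play σ ms → (v : Fin 4 → Fin n) → (∀ {i j} → i Fin.< j → v i Fin.< v j) →
          ¬ (∀ {i j} (i<j : i Fin.< j) (vi<vj : v i Fin.< v j) → edge (v i) (v j) vi<vj ∈ ms)
  no-K₄ {ms} p v v-mono clique with completePlay (missing ms) ≤-refl p
  ... | ms′ , p′ , ⊆′ , all with proj₂ winning p′ all (image v) (∣image∣ v v-mono)
  ...   | e , e∈B , lo∈ , hi∈ with ∈-image⁻ v lo∈ | ∈-image⁻ v hi∈
  ...     | i , lo≡ | j , hi≡ = claims-disjoint p′ (⊆′ e∈ms) e∈B
    where
    vi<vj : v i Fin.< v j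
    vi<vj = subst₂ Fin._<_ lo≡ hi≡ (lo<hi e)
    i<j : i Fin.< j
    i<j with Fin.<-cmp i j
    ... | tri< i<j _ _  = i<j
    ... | tri≈ _ refl _ = contradiction vi<vj (<-irrefl refl)
    ... | tri> _ _ j<i  = contradiction (v-mono j<i) (<-asym vi<vj)
    e∈ms : e ∈ ms
    e∈ms = subst (_∈ ms) (edge-≡ (sym lo≡) (sym hi≡)) (clique i<j vi<vj)

-- One stage of Maker's strategy

module PartiteGame {n m : ℕ} (4m≤n : 4 * m ≤ n) .{{_ : NonZero m}} {σ : Strategy n} (q : ℕ)
                   (budget : ∀ {ms} → Play σ ms → length (breakerEdges σ ms) ≤ q * length ms) where

  open Tuples m
  open Families m 4
  open Constraint

  -- `combine` makes the parts consecutive blocks of `m` vertices, so an edge between parts `i < j`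
  -- has its end in part `i` as `lo`.
  vertex : Fin 4 → Fin m → Fin n
  vertex i x = Fin.inject≤ (Fin.combine i x) 4m≤n

  vertex-mono : ∀ {i j} → i Fin.< j → ∀ x y → vertex i x Fin.< vertex j y
  vertex-mono i<j x y = subst₂ _<_ (sym (Fin.toℕ-inject≤ _ 4m≤n)) (sym (Fin.toℕ-inject≤ _ 4m≤n))
                               (Fin.combine-monoˡ-< x y i<j)

  vertex-injective : ∀ i {x y} → vertex i x ≡ vertex i y → x ≡ y
  vertex-injective i {x} {y} eq =
    Fin.combine-injectiveʳ i x i y (Fin.inject≤-injective 4m≤n 4m≤n _ _ eq)

  edgeOf : ∀ {i j} → i Fin.< j → Tuple → Edge n
  edgeOf {i} {j} i<j t = edge (vertex i (lookup t i)) (vertex j (lookup t j)) (vertex-mono i<j _ _)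

  claims : List (Edge n) → List (Edge n)
  claims ms = ms ++ breakerEdges σ ms

  length-claims : ∀ {ms} → Play σ ms → length (claims ms) ≤ suc q * length ms
  length-claims {ms} p = ≤-trans (≤-reflexive (length-++ ms)) (+-monoʳ-≤ (length ms) (budget p))

  record Outcome {i j} (i<j : i Fin.< j) (ms : List (Edge n)) (X : Family) (rounds goal : ℕ)
                 (κs : List Constraint) : Set where
    field
      moves   : List (Edge n)
      play    : Play σ moves
      earlier : ms ⊆ moves
      short   : length moves ≤ length ms + rounds
      family  : Family
      inside  : family ⊑ X
      claimed : ∀ t → T (family t) → edgeOf i<j t ∈ moves
      large   : goal ≤ # family
      degrees : ∀ {κ} → κ ∈ κs → DegreesAtMost (new κ) (mask κ) family

  module _ {i j : Fin 4} (i<j : i Fin.< j) where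

    private
      E : Subset 4
      E = ⁅ i ⁆ ∪ ⁅ j ⁆

    same⇒edgeOf≡ : ∀ {t u} → T (same E t u) → edgeOf i<j t ≡ edgeOf i<j u
    same⇒edgeOf≡ {t} {u} s = edge-≡
      (cong (vertex i) (same⇒lookup≡ E t u s (x∈p∪q⁺ (inj₁ (x∈⁅x⁆ i)))))
      (cong (vertex j) (same⇒lookup≡ E t u s (x∈p∪q⁺ {p = ⁅ i ⁆} (inj₂ (x∈⁅x⁆ j)))))

    edgeOf≡⇒same : ∀ {t u} → edgeOf i<j t ≡ edgeOf i<j u → T (same E t u)
    edgeOf≡⇒same {t} {u} eq = lookup≡⇒same E t u (agree ∘ x∈p∪q⁻ ⁅ i ⁆ ⁅ j ⁆)
      where
      agree : ∀ {l} → l ∈ₛ ⁅ i ⁆ ⊎ l ∈ₛ ⁅ j ⁆ → lookup t l ≡ lookup u l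
      agree (inj₁ l∈) rewrite x∈⁅y⁆⇒x≡y i l∈ = vertex-injective i (cong lo eq)
      agree (inj₂ l∈) rewrite x∈⁅y⁆⇒x≡y j l∈ = vertex-injective j (cong hi eq)

    open Key _≟ᴱ_ E (edgeOf i<j) same⇒edgeOf≡ edgeOf≡⇒same

    -- `extend` is iterated from the empty family. The bound `c` covers all claims up to the end of
    -- the stage, so the same inequality `room` serves every round.
    stage : ∀ {ms X size goal gain rounds d c κs} → Play σ ms → suc q * (length ms + rounds) ≤ c →
            All (Admissible X E goal) κs → DegreesAtMost d E X →
            size ≤ # X → m ^ ∣ E ∣ * gain + (∑ κs lost + c * d) < size → goal ≤ rounds * suc gain →
            Outcome i<j ms X rounds goal κs
    stage {ms} {X} {size} {goal} {gain} {rounds} {d} {c} {κs} p₀ few αs E-bound size≤ room enough =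
      loop rounds (λ _ → false) p₀ (λ e∈ → e∈) ≤-refl (λ _ ()) (λ _ ())
           (λ κ∈ → degrees≤ λ t → #-bound λ _ ())
           (≤-trans enough (m≤n+m _ _))
      where
      -- Invariant: gains of `suc gain` in each of the `r` remaining rounds still lead to `goal`.
      loop : ∀ r {ms′} Y → Play σ ms′ → ms ⊆ ms′ → length ms′ + r ≤ length ms + rounds →
             Y ⊑ X → (∀ t → T (Y t) → edgeOf i<j t ∈ ms′) →
             (∀ {κ} → κ ∈ κs → DegreesAtMost (new κ) (mask κ) Y) →
             goal ≤ # Y + r * suc gain → Outcome i<j ms X rounds goal κs
      -- Stopping once `goal` is reached ensures `# Y ≤ goal` before every move, as the count of
      -- saturated tuples requires.
      loop r {ms′} Y p ms⊆ short Y⊑X Y-claimed Y-bounds goal≤ with ≤-total goal (# Y)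
      ... | inj₁ done = record
        { moves = ms′ ; play = p ; earlier = ms⊆ ; short = m+n≤o⇒m≤o _ short
        ; family = Y ; inside = Y⊑X ; claimed = Y-claimed ; large = done ; degrees = Y-bounds }
      loop zero {ms′} Y p ms⊆ short Y⊑X Y-claimed Y-bounds goal≤ | inj₂ _ = record
        { moves = ms′ ; play = p ; earlier = ms⊆ ; short = m+n≤o⇒m≤o _ short
        ; family = Y ; inside = Y⊑X ; claimed = Y-claimed
        ; large = ≤-trans goal≤ (≤-reflexive (+-identityʳ _)) ; degrees = Y-bounds }
      loop (suc r) {ms′} Y p ms⊆ short Y⊑X Y-claimed Y-bounds goal≤ | inj₂ #Y≤ =
        loop r family (move p (fresh ∘ ∈-++⁺ˡ , fresh ∘ ∈-++⁺ʳ ms′)) (λ e∈ → there (ms⊆ e∈))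
             (≤-trans (≤-reflexive (sym (+-suc _ r))) short)
             inside (λ t Ft → claimed t (keys t Ft)) degrees
             (≤-trans goal≤ (≤-trans (≤-reflexive (sym (+-assoc (# Y) (suc gain) _))) (+-monoˡ-≤ _ grown)))
        where
        ext : Extension X Y κs (suc gain) (claims ms′)
        ext = extend αs E-bound Y⊑X (λ t Yt → ∈-++⁺ˡ (Y-claimed t Yt)) #Y≤ Y-bounds
          (≤-trans (length-claims p) (≤-trans (*-monoʳ-≤ (suc q) (m+n≤o⇒m≤o _ short)) few))
          (<-≤-trans room size≤)
        open Extension ext
        claimed : ∀ t → T (Y t) ⊎ edgeOf i<j t ≡ edgeOf i<j tuple → edgeOf i<j t ∈ edgeOf i<j tuple ∷ ms′
        claimed t (inj₁ Yt) = there (Y-claimed t Yt)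
        claimed t (inj₂ eq) = here eq

-- The monomials a hᵉ are opaque because multiplication by a huge numeral a would be unfolded in unary.
module Monomials (h : ℕ) .{{_ : NonZero h}} where

  infixl 7 _·h^_

  opaque
    _·h^_ : ℕ → ℕ → ℕ
    a ·h^ e = a * h ^ e

    ·h^-unfold : ∀ a e → a ·h^ e ≡ a * h ^ e
    ·h^-unfold a e = refl

    ·h^-* : ∀ a b e f → (a ·h^ e) * (b ·h^ f) ≡ (a * b) ·h^ (e + f)
    ·h^-* a b e f = trans ([m*n]*[o*p]≡[m*o]*[n*p] a (h ^ e) b (h ^ f))
                          (cong (a * b *_) (sym (^-distribˡ-+-* h e f)))

    ·h^-+ : ∀ a b e → a ·h^ e + b ·h^ e ≡ (a + b) ·h^ e
    ·h^-+ a b e = sym (*-distribʳ-+ (h ^ e) a b)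

    ·h^-mono-≤ : ∀ {a b e f} → a ≤ b → e ≤ f → a ·h^ e ≤ b ·h^ f
    ·h^-mono-≤ a≤b e≤f = *-mono-≤ a≤b (^-monoʳ-≤ h e≤f)

    ·h^-mono-< : ∀ {a b e f} → a < b → e ≤ f → a ·h^ e < b ·h^ f
    ·h^-mono-< {b = b} {e = e} a<b e≤f =
      <-≤-trans (*-monoˡ-< (h ^ e) {{m^n≢0 h e}} a<b) (*-monoʳ-≤ b (^-monoʳ-≤ h e≤f))

  ≤-to-·h^ : ∀ a e {x} → a * h ^ e ≤ x → a ·h^ e ≤ x
  ≤-to-·h^ a e le = ≤-trans (≤-reflexive (·h^-unfold a e)) le

  -- Coefficient and exponent sit in the type, so that `_⊕_` and `_⊛_` compute them and inequalities
  -- reduce to comparisons of numerals.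
  record Monomial (x a e : ℕ) : Set where
    constructor monomial
    field value : x ≡ a ·h^ e

  open Monomial

  infixl 6 _⊕_
  infixl 7 _⊛_

  term : ∀ {a e} → Monomial (a ·h^ e) a e
  term = monomial refl

  -- The exponent is arbitrary, so that zero can end a sum of any degree in `h`.
  nought : ∀ {e} → Monomial 0 0 e
  nought {e} = monomial (sym (·h^-unfold 0 e))

  numeral : ∀ {a} → Monomial a a 0
  numeral {a} = monomial (sym (trans (·h^-unfold a 0) (*-identityʳ a)))

  _⊛_ : ∀ {x y a b e f} → Monomial x a e → Monomial y b f → Monomial (x * y) (a * b) (e + f)
  monomial refl ⊛ monomial refl = monomial (·h^-* _ _ _ _)

  _⊕_ : ∀ {x y a b e} → Monomial x a e → Monomial y b e → Monomial (x + y) (a + b) e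
  monomial refl ⊕ monomial refl = monomial (·h^-+ _ _ _)

  by-coefficients-≤ : ∀ {x y a b e f} → Monomial x a e → Monomial y b f →
                      {T (e ≤ᵇ f)} → T (a ≤ᵇ b) → x ≤ y
  by-coefficients-≤ (monomial refl) (monomial refl) {e≤f} a≤b = ·h^-mono-≤ (≤ᵇ⇒≤ _ _ a≤b) (≤ᵇ⇒≤ _ _ e≤f)

  by-coefficients-< : ∀ {x y a b e f} → Monomial x a e → Monomial y b f →
                      {T (e ≤ᵇ f)} → T (a <ᵇ b) → x < y
  by-coefficients-< (monomial refl) (monomial refl) {e≤f} a<b = ·h^-mono-< (<ᵇ⇒< _ _ a<b) (≤ᵇ⇒≤ _ _ e≤f)

  term≢0 : ∀ {a e} → T (1 ≤ᵇ a) → NonZero (a ·h^ e)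
  term≢0 {a} {e} 1≤a = >-nonZero (by-coefficients-≤ (numeral {1}) (term {a} {e}) 1≤a)

  -- This is `cap+slack≤new` for pairs: since `h ≥ 1`, a slack with no larger exponent is absorbed
  -- by the coefficient.
  overshoot : ∀ a b c {e f} → {T (f ≤ᵇ e)} → T (a + b ≤ᵇ c) → a ·h^ e + b ·h^ f ≤ suc (c ·h^ e)
  overshoot a b c {e} {f} {f≤e} a+b≤c = m≤n⇒m≤1+n (≤-trans
    (+-monoʳ-≤ (a ·h^ e) (·h^-mono-≤ (≤-refl {b}) (≤ᵇ⇒≤ f e f≤e)))
    (by-coefficients-≤ (term ⊕ term) term {≤⇒≤ᵇ (≤-refl {e})} a+b≤c))

-- The six stages

module _ {n h q : ℕ} {rule : Rule n} {σ : Strategy n} .{{_ : NonZero h}}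
         (winning : IsWinning rule σ)
         (budget : ∀ {ms} → Play σ ms → length (breakerEdges σ ms) ≤ q * length ms) where

  open Monomials h

  -- m is the size of the parts, R the number of rounds per stage, and C bounds the number of edges claimed by both
  -- players together.  For 1/p = 2¹² h², so that R = p m², a degree on j ≤ 3 coordinates of a family whose edges
  -- of the types built so far are present with density p is of order m⁴⁻ʲ times a power of p; the caps below are
  -- these orders with constant factors for which the excluded tuples number about half of the previous family,
  -- and with final degree 1.  In the chosen order of the edge types, every triple on which a bound is needed has,
  -- once it is needed, degree of smaller order than the caps of the pairs in it, so that the slack is negligible.
  private
    m R C : ℕ
    m = 2 ^ 29 ·h^ 5
    R = 2 ^ 46 ·h^ 8
    C = 2 ^ 44 ·h^ 10

    instance
      m≢0 : NonZero m
      m≢0 = term≢0 tt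

    abc : Subset 4
    abc = true ∷ true ∷ true ∷ false ∷ []
    abd : Subset 4
    abd = true ∷ true ∷ false ∷ true ∷ []
    acd : Subset 4
    acd = true ∷ false ∷ true ∷ true ∷ []
    bcd : Subset 4
    bcd = false ∷ true ∷ true ∷ true ∷ []
    ab : Subset 4
    ab = true ∷ true ∷ false ∷ false ∷ []
    ac : Subset 4
    ac = true ∷ false ∷ true ∷ false ∷ []
    bc : Subset 4
    bc = false ∷ true ∷ true ∷ false ∷ []
    bd : Subset 4
    bd = false ∷ true ∷ false ∷ true ∷ []
    cd : Subset 4
    cd = false ∷ false ∷ true ∷ true ∷ []

    va vb vc vd : Fin 4
    va = zero
    vb = suc zero
    vc = suc (suc zero)
    vd = suc (suc (suc zero))

    a<b : va Fin.< vb
    a<b = z<s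
    a<c : va Fin.< vc
    a<c = z<s
    a<d : va Fin.< vd
    a<d = z<s
    b<c : vb Fin.< vc
    b<c = s<s z<s
    b<d : vb Fin.< vd
    b<d = s<s z<s
    c<d : vc Fin.< vd
    c<d = s<s (s<s z<s)

  -- `2 ^ 31 ·h^ 5` is `4 * m`. The six stages take at most `6 * R` moves, and 6 · 2⁴⁶ = 24 · 2⁴⁴,
  -- so the first hypothesis keeps the claims of both players within `C`.
  small-bias-loses : 24 * suc q ≤ h ^ 2 → 2 ^ 31 ·h^ 5 ≤ n → Empty.⊥
  small-bias-loses q≤ n≥ = no-K₄ {rule = rule} winning o₆.play
                           (λ i → vertex i (lookup t i)) (λ i<j → vertex-mono i<j _ _) clique
    where
    4m≤n : 4 * m ≤ n
    4m≤n = ≤-trans (≤-reflexive (Monomial.value (numeral {4} ⊛ term {2 ^ 29} {5}))) n≥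
    open PartiteGame {m = m} 4m≤n {σ = σ} q budget
    open Families m 4
    open Tuples m
    few : ∀ i {l} → {T (suc i ≤ᵇ 6)} → l ≤ i * R → suc q * (l + R) ≤ C
    few i {l} {i<6} l≤ = begin
      suc q * (l + R)          ≤⟨ *-monoʳ-≤ (suc q) (+-monoˡ-≤ R l≤) ⟩
      suc q * (i * R + R)      ≡⟨ cong (suc q *_) (+-comm (i * R) R) ⟩
      suc q * (suc i * R)      ≤⟨ *-monoʳ-≤ (suc q) (*-monoˡ-≤ R (≤ᵇ⇒≤ (suc i) 6 i<6)) ⟩
      suc q * (6 * R)          ≤⟨ *-monoʳ-≤ (suc q) (by-coefficients-≤ (numeral {6} ⊛ term {2 ^ 46} {8})
                                                                       (numeral {24} ⊛ term {2 ^ 44} {8}) tt) ⟩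
      suc q * (24 * R′)        ≡⟨ *-assoc (suc q) 24 R′ ⟨
      suc q * 24 * R′          ≡⟨ cong (_* R′) (*-comm (suc q) 24) ⟩
      24 * suc q * R′          ≤⟨ *-monoˡ-≤ R′ q≤ ⟩
      h ^ 2 * R′               ≡⟨ cong (_* R′) (trans (·h^-unfold 1 2) (*-identityˡ (h ^ 2))) ⟨
      1 ·h^ 2 * R′             ≤⟨ by-coefficients-≤ (term {1} {2} ⊛ term {2 ^ 44} {8}) term tt ⟩
      C                        ∎
      where
      open ≤-Reasoning
      R′ = 2 ^ 44 ·h^ 8
    next : ∀ i {l l′} → l ≤ i * R → l′ ≤ l + R → l′ ≤ suc i * R
    next i {l} {l′} l≤ l′≤ = ≤-trans l′≤ (≤-trans (+-monoˡ-≤ R l≤) (≤-reflexive (+-comm (i * R) R)))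

    X₀ : Family
    X₀ _ = true
    size₀ : 2 ^ 116 ·h^ 20 ≤ # X₀
    size₀ = ≤-trans (by-coefficients-≤ term (term ⊛ (term ⊛ (term ⊛ (term ⊛ numeral)))) tt)
                    (≤-reflexive (sym (trans (∑-const (tuples 4) 1) (trans (*-identityʳ _) (length-tuples 4)))))

    m² : Monomial (m * (m * 1)) (2 ^ 58) 10
    m² = term ⊛ (term ⊛ numeral)

    free₁ : ∀ {X M} → ∣ ∁ M ∣ ≡ 1 → DegreesAtMost m M X
    free₁ {X} {M} eq = degrees-≤ (≤-reflexive (trans (cong (m ^_) eq) (*-identityʳ m))) (degrees-free X M)

    free₂ : ∀ {X M} → ∣ ∁ M ∣ ≡ 2 → DegreesAtMost (2 ^ 58 ·h^ 10) M X
    free₂ {X} {M} eq = degrees-≤ (≤-trans (≤-reflexive (cong (m ^_) eq)) (by-coefficients-≤ m² term tt))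
                                 (degrees-free X M)

    unit-slack : ∀ {c} → c + 1 ≤ suc c
    unit-slack {c} = ≤-reflexive (+-comm c 1)

    -- In each of the first five stages `gain` is a quarter of the average class size of the
    -- previous family, and the goal is `R * gain`. Three quarters of that family may thus be lost
    -- to caps and claimed pairs. Here each triple together with `ad` covers all four vertices, so
    -- the slack is 1.
    κs₁ : List Constraint
    κs₁ = constraint abc m (2 ^ 17 ·h^ 3) 1 (2 ^ 17 ·h^ 3) (2 ^ 114 ·h^ 20)
        ∷ constraint bcd m (2 ^ 17 ·h^ 3) 1 (2 ^ 17 ·h^ 3) (2 ^ 114 ·h^ 20) ∷ []
    opaque
      o₁ : Outcome a<d [] X₀ R (2 ^ 102 ·h^ 18) κs₁
      o₁ = stage a<d {gain = 2 ^ 56 ·h^ 10} start (few 0 z≤n)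
        ( admissible (free₁ refl) (degrees-free X₀ _) unit-slack
            (by-coefficients-≤ (term ⊛ term) (term ⊛ term) tt) (term≢0 tt)
        ∷ admissible (free₁ refl) (degrees-free X₀ _) unit-slack
            (by-coefficients-≤ (term ⊛ term) (term ⊛ term) tt) (term≢0 tt)
        ∷ [])
        (free₂ refl) size₀
        (by-coefficients-< (m² ⊛ term ⊕ (term ⊕ (term ⊕ nought) ⊕ term ⊛ term)) term tt)
        (≤-trans (by-coefficients-≤ term (term ⊛ term) tt) (*-monoʳ-≤ R (n≤1+n _)))
    module o₁ = Outcome o₁
    X₁ = o₁.family
    short₁ : length o₁.moves ≤ 1 * R
    short₁ = next 0 z≤n o₁.short

    abc₁ : DegreesAtMost (2 ^ 17 ·h^ 3) abc X₁
    abc₁ = o₁.degrees (here refl)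
    bcd₁ : DegreesAtMost (2 ^ 17 ·h^ 3) bcd X₁
    bcd₁ = o₁.degrees (there (here refl))
    -- `i` is the vertex that completes the pair `M` to `abc` or `bcd`.
    pair₁ : ∀ {M} i → DegreesAtMost (2 ^ 17 ·h^ 3) (M [ i ]≔ true) X₁ → DegreesAtMost (2 ^ 46 ·h^ 8) M X₁
    pair₁ i d = degrees-≤ (by-coefficients-≤ (term ⊛ term) term tt) (degrees-forget i d)

    -- The pair cap is 7/8 of the bound `2 ^ 36 ·h^ 6`, leaving an eighth for the slack; stages
    -- three and four use the same proportion. The factor 300 is 2¹⁴ / 56, as needed for
    -- `goal*old≤lost`, generously rounded up.
    pair-constraint₂ triple-constraint₂ : Subset 4 → Constraint
    pair-constraint₂ M   = constraint M (2 ^ 46 ·h^ 8) (56 * 2 ^ 30 ·h^ 6) (2 ^ 17 ·h^ 3)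
                                      (2 ^ 36 ·h^ 6) (300 * 2 ^ 90 ·h^ 18)
    triple-constraint₂ M = constraint M m (2 ^ 18 ·h^ 3) 1 (2 ^ 18 ·h^ 3) (2 ^ 99 ·h^ 18)
    κs₂ : List Constraint
    κs₂ = pair-constraint₂ bd ∷ pair-constraint₂ ac ∷ pair-constraint₂ ab ∷ pair-constraint₂ cd
        ∷ triple-constraint₂ abd ∷ triple-constraint₂ acd ∷ []
    opaque
      o₂ : Outcome b<c o₁.moves X₁ R (2 ^ 88 ·h^ 16) κs₂
      o₂ = stage b<c {gain = 2 ^ 42 ·h^ 8} o₁.play (few 1 short₁)
        ( pair bd (pair₁ vc bcd₁) bcd₁ ∷ pair ac (pair₁ vb abc₁) abc₁
        ∷ pair ab (pair₁ vc abc₁) abc₁ ∷ pair cd (pair₁ vb bcd₁) bcd₁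
        ∷ triple abd (free₁ refl) (degrees-free X₁ _) ∷ triple acd (free₁ refl) (degrees-free X₁ _) ∷ [])
        (pair₁ va abc₁) o₁.large
        -- In units of `2 ^ 90 ·h^ 18`: 1024 for the gain, 1200 for the pairs, 1024 for the triples
        -- and 1 for the claimed edges, against 4096.
        (by-coefficients-< (m² ⊛ term ⊕ (term ⊕ (term ⊕ (term ⊕ (term ⊕ (term ⊕ (term ⊕ nought))))) ⊕ term ⊛ term)) term tt)
        (≤-trans (by-coefficients-≤ term (term ⊛ term) tt) (*-monoʳ-≤ R (n≤1+n _)))
        where
        pair : ∀ M → DegreesAtMost (2 ^ 46 ·h^ 8) M X₁ → DegreesAtMost (2 ^ 17 ·h^ 3) (bc ∪ M) X₁ →
               Admissible X₁ bc (2 ^ 88 ·h^ 16) (pair-constraint₂ M)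
        pair M old slack = admissible old slack (overshoot (56 * 2 ^ 30) (2 ^ 17) (2 ^ 36) tt)
          (by-coefficients-≤ (term ⊛ term) (term ⊛ term) tt) (term≢0 tt)
        triple : ∀ M → DegreesAtMost m M X₁ → DegreesAtMost 1 (bc ∪ M) X₁ →
                 Admissible X₁ bc (2 ^ 88 ·h^ 16) (triple-constraint₂ M)
        triple M old slack = admissible old slack unit-slack
          (by-coefficients-≤ (term ⊛ term) (term ⊛ term) tt) (term≢0 tt)
    module o₂ = Outcome o₂
    X₂ = o₂.family
    short₂ : length o₂.moves ≤ 2 * R
    short₂ = next 1 short₁ o₂.short

    abc₂ : DegreesAtMost (2 ^ 18 ·h^ 3) abc X₂
    abc₂ = degrees-≤ (by-coefficients-≤ term term tt) (degrees-⊑ o₂.inside abc₁)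
    bcd₂ : DegreesAtMost (2 ^ 18 ·h^ 3) bcd X₂
    bcd₂ = degrees-≤ (by-coefficients-≤ term term tt) (degrees-⊑ o₂.inside bcd₁)
    abd₂ : DegreesAtMost (2 ^ 18 ·h^ 3) abd X₂
    abd₂ = o₂.degrees (there (there (there (there (here refl)))))
    acd₂ : DegreesAtMost (2 ^ 18 ·h^ 3) acd X₂
    acd₂ = o₂.degrees (there (there (there (there (there (here refl))))))
    -- For `ac`, which together with `bd` fixes the whole tuple: the degree 1 is relaxed to the
    -- common slack of `pair-constraint₃`.
    disjoint₂ : ∀ {M} → ∣ ∁ M ∣ ≡ 0 → DegreesAtMost (2 ^ 18 ·h^ 3) M X₂
    disjoint₂ {M} eq = degrees-≤ (≤-trans (≤-reflexive (cong (m ^_) eq)) (by-coefficients-≤ numeral term tt))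
                                 (degrees-free X₂ M)

    pair-constraint₃ triple-constraint₃ : Subset 4 → Constraint
    pair-constraint₃ M   = constraint M (2 ^ 36 ·h^ 6) (28 * 2 ^ 20 ·h^ 4) (2 ^ 18 ·h^ 3)
                                      (2 ^ 25 ·h^ 4) (37 * 2 ^ 80 ·h^ 16)
    triple-constraint₃ M = constraint M (2 ^ 18 ·h^ 3) (2 ^ 10 ·h^ 1) 1 (2 ^ 10 ·h^ 1) (2 ^ 82 ·h^ 16)
    κs₃ : List Constraint
    κs₃ = pair-constraint₃ ac ∷ pair-constraint₃ ab ∷ pair-constraint₃ cd
        ∷ triple-constraint₃ abc ∷ triple-constraint₃ acd ∷ []
    opaque
      o₃ : Outcome b<d o₂.moves X₂ R (2 ^ 74 ·h^ 14) κs₃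
      o₃ = stage b<d {gain = 2 ^ 28 ·h^ 6} o₂.play (few 2 short₂)
        ( pair ac (o₂.degrees (there (here refl))) (disjoint₂ refl)
        ∷ pair ab (o₂.degrees (there (there (here refl)))) abd₂
        ∷ pair cd (o₂.degrees (there (there (there (here refl))))) bcd₂
        ∷ triple abc abc₂ (degrees-free X₂ _) ∷ triple acd acd₂ (degrees-free X₂ _) ∷ [])
        (o₂.degrees (here refl)) o₂.large
        (by-coefficients-< (m² ⊛ term ⊕ (term ⊕ (term ⊕ (term ⊕ (term ⊕ (term ⊕ nought)))) ⊕ term ⊛ term)) term tt)
        (≤-trans (by-coefficients-≤ term (term ⊛ term) tt) (*-monoʳ-≤ R (n≤1+n _)))
        where
        pair : ∀ M → DegreesAtMost (2 ^ 36 ·h^ 6) M X₂ → DegreesAtMost (2 ^ 18 ·h^ 3) (bd ∪ M) X₂ →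
               Admissible X₂ bd (2 ^ 74 ·h^ 14) (pair-constraint₃ M)
        pair M old slack = admissible old slack (overshoot (28 * 2 ^ 20) (2 ^ 18) (2 ^ 25) tt)
          (by-coefficients-≤ (term ⊛ term) (term ⊛ term) tt) (term≢0 tt)
        triple : ∀ M → DegreesAtMost (2 ^ 18 ·h^ 3) M X₂ → DegreesAtMost 1 (bd ∪ M) X₂ →
                 Admissible X₂ bd (2 ^ 74 ·h^ 14) (triple-constraint₃ M)
        triple M old slack = admissible old slack unit-slack
          (by-coefficients-≤ (term ⊛ term) (term ⊛ term) tt) (term≢0 tt)
    module o₃ = Outcome o₃
    X₃ = o₃.family
    short₃ : length o₃.moves ≤ 3 * R
    short₃ = next 2 short₂ o₃.short

    constraint₄ : Subset 4 → Constraint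
    constraint₄ M = constraint M (2 ^ 25 ·h^ 4) (7 * 2 ^ 10 ·h^ 2) (2 ^ 10 ·h^ 1) (2 ^ 13 ·h^ 2) (5 * 2 ^ 70 ·h^ 14)
    κs₄ : List Constraint
    κs₄ = constraint₄ ab ∷ constraint₄ cd ∷ []
    opaque
      o₄ : Outcome a<c o₃.moves X₃ R (2 ^ 60 ·h^ 12) κs₄
      o₄ = stage a<c {gain = 2 ^ 14 ·h^ 4} o₃.play (few 3 short₃)
        ( pair ab (o₃.degrees (there (here refl))) (o₃.degrees (there (there (there (here refl)))))
        ∷ pair cd (o₃.degrees (there (there (here refl))))
                  (o₃.degrees (there (there (there (there (here refl)))))) ∷ [])
        (o₃.degrees (here refl)) o₃.large
        (by-coefficients-< (m² ⊛ term ⊕ (term ⊕ (term ⊕ nought) ⊕ term ⊛ term)) term tt)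
        (≤-trans (by-coefficients-≤ term (term ⊛ term) tt) (*-monoʳ-≤ R (n≤1+n _)))
        where
        pair : ∀ M → DegreesAtMost (2 ^ 25 ·h^ 4) M X₃ → DegreesAtMost (2 ^ 10 ·h^ 1) (ac ∪ M) X₃ →
               Admissible X₃ ac (2 ^ 60 ·h^ 12) (constraint₄ M)
        pair M old slack = admissible old slack (overshoot (7 * 2 ^ 10) (2 ^ 10) (2 ^ 13) tt)
          (by-coefficients-≤ (term ⊛ term) (term ⊛ term) tt) (term≢0 tt)
    module o₄ = Outcome o₄
    X₄ = o₄.family
    short₄ : length o₄.moves ≤ 4 * R
    short₄ = next 3 short₃ o₄.short

    κs₅ : List Constraint
    κs₅ = constraint cd (2 ^ 13 ·h^ 2) 1 1 1 (2 ^ 59 ·h^ 12) ∷ []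
    opaque
      o₅ : Outcome a<b o₄.moves X₄ R (2 ^ 46 ·h^ 10) κs₅
      o₅ = stage a<b {gain = 1 ·h^ 2} o₄.play (few 4 short₄)
        ( admissible (o₄.degrees (there (here refl))) (degrees-free X₄ _) ≤-refl
            (by-coefficients-≤ (term ⊛ term) (term ⊛ numeral) tt) (>-nonZero (s≤s z≤n)) ∷ [])
        (o₄.degrees (here refl)) o₄.large
        (by-coefficients-< (m² ⊛ term ⊕ (term ⊕ nought ⊕ term ⊛ term)) term tt)
        (≤-trans (by-coefficients-≤ term (term ⊛ term) tt) (*-monoʳ-≤ R (n≤1+n _)))
    module o₅ = Outcome o₅
    X₅ = o₅.family
    short₅ : length o₅.moves ≤ 5 * R
    short₅ = next 4 short₄ o₅.short

    opaque
      o₆ : Outcome c<d o₅.moves X₅ R 1 []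
      -- The tuples of `X₅` have distinct pairs `cd` and number at least `2 ^ 46 ·h^ 10`, four times
      -- `C`; a single free pair is enough.
      o₆ = stage c<d {gain = 0} o₅.play (few 5 short₅)
        [] (o₅.degrees (here refl)) o₅.large
        (by-coefficients-< (m² ⊛ nought {0} ⊕ (nought ⊕ term ⊛ numeral)) term tt)
        (by-coefficients-≤ numeral (term ⊛ numeral) tt)
    module o₆ = Outcome o₆

    -- This tuple lies in the family of every stage, and each stage has claimed its edge of one
    -- type.
    complete-tuple : ∃[ t ] T (o₆.family t)
    complete-tuple = #-inhabited {o₆.family} o₆.large
    t = proj₁ complete-tuple
    t∈X₅ = o₆.inside t (proj₂ complete-tuple)
    t∈X₄ = o₅.inside t t∈X₅
    t∈X₃ = o₄.inside t t∈X₄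
    t∈X₂ = o₃.inside t t∈X₃
    t∈X₁ = o₂.inside t t∈X₂

    owned : ∀ {i j} (i<j : i Fin.< j) → edgeOf i<j t ∈ o₆.moves
    owned {zero} {suc zero}                  (s≤s z≤n) = o₆.earlier (o₅.claimed t t∈X₅)
    owned {zero} {suc (suc zero)}            (s≤s z≤n) = o₆.earlier (o₅.earlier (o₄.claimed t t∈X₄))
    owned {zero} {suc (suc (suc zero))}      (s≤s z≤n) =
      o₆.earlier (o₅.earlier (o₄.earlier (o₃.earlier (o₂.earlier (o₁.claimed t t∈X₁)))))
    owned {suc zero} {suc (suc zero)}        (s≤s (s≤s z≤n)) =
      o₆.earlier (o₅.earlier (o₄.earlier (o₃.earlier (o₂.claimed t t∈X₂))))
    owned {suc zero} {suc (suc (suc zero))}  (s≤s (s≤s z≤n)) =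
      o₆.earlier (o₅.earlier (o₄.earlier (o₃.claimed t t∈X₃)))
    owned {suc (suc zero)} {suc (suc (suc zero))} (s≤s (s≤s (s≤s z≤n))) =
      o₆.claimed t (proj₂ complete-tuple)
    owned {suc zero}             {suc zero}             (s≤s ())
    owned {suc (suc zero)}       {suc zero}             (s≤s ())
    owned {suc (suc zero)}       {suc (suc zero)}       (s≤s (s≤s ()))
    owned {suc (suc (suc zero))} {suc zero}             (s≤s ())
    owned {suc (suc (suc zero))} {suc (suc zero)}       (s≤s (s≤s ()))
    owned {suc (suc (suc zero))} {suc (suc (suc zero))} (s≤s (s≤s (s≤s ())))

    clique : ∀ {i j} (i<j : i Fin.< j) (vi<vj : vertex i (lookup t i) Fin.< vertex j (lookup t j)) →
             edge (vertex i (lookup t i)) (vertex j (lookup t j)) vi<vj ∈ o₆.moves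
    clique i<j vi<vj = subst (_∈ o₆.moves) (edge-≡ refl refl) (owned i<j)

-- The bound on the bias

-- Every turn has at most `q` edges, including a last one in which edges run out, so this game too
-- obeys the budget.
biasRule-budget : ∀ {n q} {σ : Strategy n} → IsLegal (biasRule q) σ →
              ∀ {ms} → Play σ ms → length (breakerEdges σ ms) ≤ q * length ms
biasRule-budget {q = q} legal start = z≤n
biasRule-budget {q = q} {σ} legal {m ∷ ms} p@(move p′ _) = begin
  length (σ (m ∷ ms) ++ breakerEdges σ ms)         ≡⟨ length-++ (σ (m ∷ ms)) ⟩
  length (σ (m ∷ ms)) + length (breakerEdges σ ms) ≤⟨ +-mono-≤ (at-most-q (proj₂ (proj₂ (legal p))))
                                                               (biasRule-budget legal p′) ⟩
  q + q * length ms                                ≡⟨ *-suc q (length ms) ⟨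
  q * suc (length ms)                              ∎
  where
  open ≤-Reasoning
  at-most-q : biasRule q (m ∷ ms) (breakerEdges σ ms) (σ (m ∷ ms)) → length (σ (m ∷ ms)) ≤ q
  at-most-q (inj₁ eq)       = ≤-reflexive eq
  at-most-q (inj₂ (lt , _)) = <⇒≤ lt

budgetRule-budget : ∀ {n q} {σ : Strategy n} → IsLegal (budgetRule q) σ →
                ∀ {ms} → Play σ ms → length (breakerEdges σ ms) ≤ q * length ms
budgetRule-budget legal start        = z≤n
budgetRule-budget legal p@(move _ _) = proj₂ (proj₂ (legal p))

^-distribʳ-* : ∀ e a b → (a * b) ^ e ≡ a ^ e * b ^ e
^-distribʳ-* zero    a b = refl
^-distribʳ-* (suc e) a b = trans (cong (a * b *_) (^-distribʳ-* e a b))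
                                 ([m*n]*[o*p]≡[m*o]*[n*p] a b (a ^ e) (b ^ e))

-- By induction on `n`: passing to `suc n` raises the root by at most one.
fifth-root : ∀ c .{{_ : NonZero c}} n → ∃[ h ] c * h ^ 5 ≤ n × n < c * suc h ^ 5
fifth-root c zero = 0 , ≤-reflexive (*-zeroʳ c) , ≤-trans (>-nonZero⁻¹ c) (≤-reflexive (sym (*-identityʳ c)))
fifth-root c (suc n) with fifth-root c n
... | h , c*h⁵≤n , n<c*h⁺⁵ with suc n <? c * suc h ^ 5
...   | yes lt = h , m≤n⇒m≤1+n c*h⁵≤n , lt
...   | no  ≮  = suc h , ≮⇒≥ ≮ , ≤-<-trans n<c*h⁺⁵ (*-monoʳ-< c (^-monoˡ-< 5 (n<1+n (suc h))))

root-large : ∀ c K {n h} → c * K ^ 5 ≤ n → n < c * suc h ^ 5 → K ≤ h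
root-large c K {n} {h} ≤n n< with K ≤? h
... | yes K≤h = K≤h
... | no  K≰h = contradiction (≤-trans n< (*-monoʳ-≤ c (^-monoˡ-≤ 5 (≰⇒> K≰h)))) (≤⇒≯ ≤n)

-- From q ≥ h²/k and n ≤ c (h + 1)⁵ with (h + 1)/h ≤ v/u, the bound B n² ≤ (A q)⁵ is a numerical inequality.
bias-bound : ∀ A B c k u v .{{_ : NonZero k}} .{{_ : NonZero u}} {q n h} →
             h ^ 2 ≤ k * q → n ≤ c * suc h ^ 5 → u * suc h ≤ v * h →
             B * c ^ 2 * k ^ 5 * v ^ 10 ≤ A ^ 5 * u ^ 10 → B * n ^ 2 ≤ (A * q) ^ 5
bias-bound A B c k u v {q} {n} {h} h²≤ n≤ h⁺≤ numeric =
  *-cancelʳ-≤ _ _ (k ^ 5 * u ^ 10) {{m*n≢0 (k ^ 5) (u ^ 10) {{m^n≢0 k 5}} {{m^n≢0 u 10}}}} (begin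
    B * n ^ 2 * (k ^ 5 * u ^ 10)
      ≤⟨ *-monoˡ-≤ (k ^ 5 * u ^ 10) (*-monoʳ-≤ B (^-monoˡ-≤ 2 n≤)) ⟩
    B * (c * suc h ^ 5) ^ 2 * (k ^ 5 * u ^ 10)
      ≡⟨ cong (λ z → B * z * (k ^ 5 * u ^ 10))
              (trans (^-distribʳ-* 2 c _) (cong (c ^ 2 *_) (^-*-assoc (suc h) 5 2))) ⟩
    B * (c ^ 2 * suc h ^ 10) * (k ^ 5 * u ^ 10)
      ≡⟨ regroup B (c ^ 2) (suc h ^ 10) (k ^ 5) (u ^ 10) ⟩
    B * c ^ 2 * k ^ 5 * (u ^ 10 * suc h ^ 10)
      ≡⟨ cong (B * c ^ 2 * k ^ 5 *_) (^-distribʳ-* 10 u (suc h)) ⟨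
    B * c ^ 2 * k ^ 5 * (u * suc h) ^ 10
      ≤⟨ *-monoʳ-≤ (B * c ^ 2 * k ^ 5) (^-monoˡ-≤ 10 h⁺≤) ⟩
    B * c ^ 2 * k ^ 5 * (v * h) ^ 10
      ≡⟨ cong (B * c ^ 2 * k ^ 5 *_) (^-distribʳ-* 10 v h) ⟩
    B * c ^ 2 * k ^ 5 * (v ^ 10 * h ^ 10)
      ≡⟨ *-assoc (B * c ^ 2 * k ^ 5) (v ^ 10) (h ^ 10) ⟨
    B * c ^ 2 * k ^ 5 * v ^ 10 * h ^ 10
      ≤⟨ *-monoˡ-≤ (h ^ 10) numeric ⟩
    A ^ 5 * u ^ 10 * h ^ 10
      ≡⟨ cong (A ^ 5 * u ^ 10 *_) (^-*-assoc h 2 5) ⟨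
    A ^ 5 * u ^ 10 * (h ^ 2) ^ 5
      ≤⟨ *-monoʳ-≤ (A ^ 5 * u ^ 10) (^-monoˡ-≤ 5 h²≤) ⟩
    A ^ 5 * u ^ 10 * (k * q) ^ 5
      ≡⟨ cong (A ^ 5 * u ^ 10 *_) (^-distribʳ-* 5 k q) ⟩
    A ^ 5 * u ^ 10 * (k ^ 5 * q ^ 5)
      ≡⟨ regroup′ (A ^ 5) (u ^ 10) (k ^ 5) (q ^ 5) ⟩
    A ^ 5 * q ^ 5 * (k ^ 5 * u ^ 10)
      ≡⟨ cong (_* (k ^ 5 * u ^ 10)) (^-distribʳ-* 5 A q) ⟨
    (A * q) ^ 5 * (k ^ 5 * u ^ 10) ∎)
  where
  open ≤-Reasoning
  regroup : ∀ B c h k u → B * (c * h) * (k * u) ≡ B * c * k * (u * h)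
  regroup = solve-∀
  regroup′ : ∀ a u k q → a * u * (k * q) ≡ a * q * (k * u)
  regroup′ = solve-∀

-- Let `h` be the rounded-down fifth root of n/c. Either it is large enough for Maker to win, or
-- `h ^ 2 < 24 * suc q`. In the latter case `h ≥ 101` forces `q ≥ 24`, hence `h ^ 2 ≤ 25 * q`, and
-- makes (h + 1)/h at most 101/100.
scale-or-bound : ∀ A B c .{{_ : NonZero c}} {q n} → c * 101 ^ 5 ≤ n →
                 B * c ^ 2 * 25 ^ 5 * 101 ^ 10 ≤ A ^ 5 * 100 ^ 10 →
                 (∃[ h ] NonZero h × 24 * suc q ≤ h ^ 2 × c * h ^ 5 ≤ n) ⊎ B * n ^ 2 ≤ (A * q) ^ 5
scale-or-bound A B c {q} {n} n-large numeric with fifth-root c n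
... | h , ≤n , n< with 24 * suc q ≤? h ^ 2
...   | yes q≤ = inj₁ (h , >-nonZero (≤-trans (s≤s z≤n) (root-large c 101 n-large n<)) , q≤ , ≤n)
...   | no  q≰ = inj₂ (bias-bound A B c 25 100 101 h²≤25q (<⇒≤ n<) h⁺≤ numeric)
  where
  open ≤-Reasoning
  101≤h : 101 ≤ h
  101≤h = root-large c 101 n-large n<
  h⁺≤ : 100 * suc h ≤ 101 * h
  h⁺≤ = begin
    100 * suc h    ≡⟨ *-suc 100 h ⟩
    100 + 100 * h  ≤⟨ +-monoˡ-≤ (100 * h) (≤-trans (n≤1+n 100) 101≤h) ⟩
    101 * h        ∎
  24≤q : 24 ≤ q
  24≤q with 24 ≤? q
  ... | yes le = le
  ... | no  ≰q = contradiction (begin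
    24 * suc q  ≤⟨ *-monoʳ-≤ 24 (≰⇒> ≰q) ⟩
    24 * 24     ≤⟨ ≤ᵇ⇒≤ (24 * 24) (101 ^ 2) tt ⟩
    101 ^ 2     ≤⟨ ^-monoˡ-≤ 2 101≤h ⟩
    h ^ 2       ∎) q≰
  h²≤25q : h ^ 2 ≤ 25 * q
  h²≤25q = begin
    h ^ 2        ≤⟨ <⇒≤ (≰⇒> q≰) ⟩
    24 * suc q   ≡⟨ *-suc 24 q ⟩
    24 + 24 * q  ≤⟨ +-monoˡ-≤ (24 * q) 24≤q ⟩
    25 * q       ∎

-- Both games enter through the same budget condition. The lower bound on `n` makes the fifth root
-- at least 101.
weak-breaker-loses : ∀ {n q} {rule : Rule n} {σ : Strategy n} → 2 ^ 31 * 101 ^ 5 ≤ n → IsWinning rule σ →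
                     (∀ {ms} → Play σ ms → length (breakerEdges σ ms) ≤ q * length ms) →
                     q ≥6·10⁻⁶· n ^⅖
weak-breaker-loses {n} {q} {rule} n-large winning budget =
  conclude (scale-or-bound (10 ^ 6) (6 ^ 5) (2 ^ 31) n-large
             -- The left side is about 0.39 times the right side.
             (≤ᵇ⇒≤ (6 ^ 5 * (2 ^ 31) ^ 2 * 25 ^ 5 * 101 ^ 10) ((10 ^ 6) ^ 5 * 100 ^ 10) tt))
  where
  conclude : (∃[ h ] NonZero h × 24 * suc q ≤ h ^ 2 × 2 ^ 31 * h ^ 5 ≤ n) ⊎ q ≥6·10⁻⁶· n ^⅖ → q ≥6·10⁻⁶· n ^⅖
  conclude (inj₁ (h , h≢0 , q≤ , ≤n)) =
    ⊥-elim (small-bias-loses {h = h} {q} {rule} {{h≢0}} winning budget q≤ (Monomials.≤-to-·h^ h {{h≢0}} (2 ^ 31) 5 ≤n))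
  conclude (inj₂ bound) = bound

theorem1p10 : ∃[ N ] (∀ (n : ℕ) → N ≤ n →
    (∀ (q : ℕ) → IsK₄Threshold n q → q ≥6·10⁻⁶· n ^⅖) ×
    (∀ (q : ℕ) → IsBudgetK₄Threshold n q → q ≥6·10⁻⁶· n ^⅖))
theorem1p10 = 2 ^ 31 * 101 ^ 5 , λ n N≤n →
  (λ { q ((σ , winning) , _) →
       weak-breaker-loses {q = q} {rule = biasRule q} N≤n winning (biasRule-budget {q = q} (proj₁ winning)) }) ,
  (λ { q ((σ , winning) , _) →
       weak-breaker-loses {q = q} {rule = budgetRule q} N≤n winning (budgetRule-budget {q = q} (proj₁ winning)) })
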